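{- For every positive integer $N$, $$\sum_{\lambda\in\mathcal{ROP}_N} t^{\ell(\lambda)}q^{|\lambda|}=\sum_{\mu\in\mathcal{RL}_N} t^{|\mu|_a}q^{|\mu|}=\prod_{k=1}^{N}\frac{1-t^{N-k+1}q^{\Diamond_{N,k}}}{1-tq^{2k-1}}$$ as formal power series in $t,q$.
   Context: A partition is a finite weakly decreasing sequence $\lambda=(\lambda_1\ge\lambda_2\ge\dots\ge\lambda_\ell>0)$ of positive integers (the empty partition $\emptyset$ is allowed); $\ell(\lambda)=\ell$ is its length, $|\lambda|=\sum_i\lambda_i$ its size, and $m_i(\lambda)$ the multiplicity of $i$ as a part. Partitions are identified with sequences obtained by appending zeros. The alternating size is $|\lambda|_a=\sum_{k=1}^{\ell(\lambda)}(-1)^{k+1}\lambda_k$. Trapezoidal numbers: for positive integers $k\le n$, $\Diamond_{n,k}=n+(n-1)+\dots+(n-2k+2)$ if $k\le n/2$, and $\Diamond_{n,k}=n+(n-1)+\dots+(2k-n-1)$ if $k>n/2$ (sums over all consecutive integers between the two ends). Lecture hall partitions. For a positive integer $N$, $\mathcal{L}_N$ is the set of partitions $\mu$ with $\ell(\mu)\le N$ and $$\frac{\mu_1}{N}\ge\frac{\mu_2}{N-1}\ge\dots\ge\frac{\mu_{\ell(\mu)}}{N-\ell(\mu)+1}$$ ($\emptyset\in\mathcal{L}_N$). A partition $\mu\in\mathcal{L}_N$ is reduced if for every $i$ with $1\le i\le \ell(\mu)$ the sequence obtained from $\mu$ by replacing $\mu_i$ with $\mu_i-(N-i+1)$ (and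 leaving the other entries unchanged) is not in $\mathcal{L}_N$; here trailing zeros are deleted, and a sequence that is not a partition is not in $\mathcal{L}_N$. $\mathcal{RL}_N$ is the set of reduced elements of $\mathcal{L}_N$. Odd partitions. $\mathcal{OP}_N$ is the set of partitions all of whose parts are odd and at most $2N$, and $\mathcal{ROP}_N=\{\lambda\in\mathcal{OP}_N : m_{2k-1}(\lambda)\le N-k \text{ for all } 1\le k\le N\}$. -}

module Defs where

open import Data.Bool using (if_then_else_; _∧_)
open import Data.Fin using (Fin; toℕ)
open import Data.Integer as ℤ using (ℤ; +_; 0ℤ; 1ℤ)
open import Data.List using (List; []; _∷_; length; lookup; filter; zipWith; downFrom; applyUpTo; foldr; _[_]%=_)
open import Data.List.Membership.Propositional using (_∈_)
open import Data.List.Relation.Unary.All using (All)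
open import Data.List.Relation.Unary.Linked using (Linked)
open import Data.List.Relation.Unary.Unique.Propositional using (Unique)
open import Data.Nat using (ℕ; zero; suc; _+_; _*_; _∸_; _≤_; _≥_; _>_; _≡ᵇ_; _≤ᵇ_; _≟_)
open import Data.Nat.Divisibility using (_∤_)
open import Data.Nat.ListAction using (sum)
open import Data.Product using (_×_; ∃-syntax)
open import Data.Rational.Unnormalised as ℚᵘ using (ℚᵘ; mkℚᵘ)
open import Function using (_⇔_; _∘_)
open import Relation.Binary.PropositionalEquality using (_≡_)
open import Relation.Nullary using (¬_)

record IsPartition (xs : List ℕ) : Set where
  field
    decreasing : Linked _≥_ xs
    positive   : All (_> 0) xs

mult : ℕ → List ℕ → ℕ
mult i xs = length (filter (_≟ i) xs)

-- x₁ - (x₂ - (x₃ - …)) = x₁ - x₂ + x₃ - …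
altSize : List ℕ → ℤ
altSize []       = 0ℤ
altSize (x ∷ xs) = + x ℤ.- altSize xs

-- lo + (lo + 1) + … + hi
sumFromTo : ℕ → ℕ → ℕ
sumFromTo lo hi = sum (applyUpTo (λ i → lo + i) (suc hi ∸ lo))

-- Used for 1 ≤ k ≤ n, where neither subtraction truncates.
◇ : ℕ → ℕ → ℕ
◇ n k = if 2 * k ≤ᵇ n then sumFromTo (n + 2 ∸ 2 * k) n
                      else sumFromTo (2 * k ∸ (n + 1)) n

-- The list μ₁/N, μ₂/(N-1), …; mkℚᵘ p d is the fraction p/(d+1), and
-- downFrom N is N-1, …, 0.
ratios : ℕ → List ℕ → List ℚᵘ
ratios N μ = zipWith (λ x d → mkℚᵘ (+ x) d) μ (downFrom N)

record LectureHall (N : ℕ) (μ : List ℕ) : Set where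
  field
    partition : IsPartition μ
    length≤N  : length μ ≤ N
    ratios↘   : Linked ℚᵘ._≥_ (ratios N μ)

dropTrailingZeros : List ℕ → List ℕ
dropTrailingZeros = foldr cons []
  where
  cons : ℕ → List ℕ → List ℕ
  cons zero [] = []
  cons x    xs = x ∷ xs

-- With i counted from 0, the amount subtracted from the entry is N - i.
-- If it exceeds the entry, the resulting sequence has a negative entry
-- and is not a partition; the first conjunct accounts for this.
record ReducedLectureHall (N : ℕ) (μ : List ℕ) : Set where
  field
    lectureHall : LectureHall N μ
    reduced     : ∀ (i : Fin (length μ)) →
                  ¬ (N ∸ toℕ i ≤ lookup μ i ×
                     LectureHall N (dropTrailingZeros (μ [ i ]%= (_∸ (N ∸ toℕ i)))))

record OddPartition (N : ℕ) (xs : List ℕ) : Set where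
  field
    partition : IsPartition xs
    odd       : All (2 ∤_) xs
    bounded   : All (_≤ 2 * N) xs

record ReducedOddPartition (N : ℕ) (xs : List ℕ) : Set where
  field
    oddPartition : OddPartition N xs
    mult≤        : ∀ k → 1 ≤ k → k ≤ N → mult (2 * k ∸ 1) xs ≤ N ∸ k

-- Formal power series in t and q over ℤ: F a b is the coefficient of tᵃ qᵇ.
Series : Set
Series = ℕ → ℕ → ℤ

infix  4 _≈ˢ_
infixl 6 _-ˢ_
infixl 7 _*ˢ_ _/ˢ_
infixr 8 _^ˢ_
infix  9 t^_q^_

_≈ˢ_ : Series → Series → Set
F ≈ˢ G = ∀ a b → F a b ≡ G a b

t^_q^_ : ℕ → ℕ → Series
(t^ m q^ n) a b = if (a ≡ᵇ m) ∧ (b ≡ᵇ n) then 1ℤ else 0ℤ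

1ˢ : Series
1ˢ = t^ 0 q^ 0

_-ˢ_ : Series → Series → Series
(F -ˢ G) a b = F a b ℤ.- G a b

-- f 0 + f 1 + … + f n
Σ≤ : ℕ → (ℕ → ℤ) → ℤ
Σ≤ zero    f = f zero
Σ≤ (suc n) f = Σ≤ n f ℤ.+ f (suc n)

_*ˢ_ : Series → Series → Series
(F *ˢ G) a b = Σ≤ a λ i → Σ≤ b λ j → F i j ℤ.* G (a ∸ i) (b ∸ j)

_^ˢ_ : Series → ℕ → Series
F ^ˢ zero  = 1ˢ
F ^ˢ suc n = F *ˢ F ^ˢ n

-- The inverse of a series with constant term 1, as the geometric series
-- Σⱼ (1 - F)ʲ.  Since 1 - F has no constant term, powers with j > a + b do not
-- contribute to the coefficient of tᵃ qᵇ.  (Junk for other constant terms.)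
inverse : Series → Series
inverse F a b = Σ≤ (a + b) λ j → ((1ˢ -ˢ F) ^ˢ j) a b

_/ˢ_ : Series → Series → Series
F /ˢ G = F *ˢ inverse G

∏₁ : ℕ → (ℕ → Series) → Series
∏₁ n f = foldr _*ˢ_ 1ˢ (applyUpTo (f ∘ suc) n)

infix 5 ∏₁
syntax ∏₁ n (λ k → F) = ∏[1≤ k ≤ n ] F

-- F is the sum of t^(e x) q^(s x) over all lists x satisfying P: the exponents
-- of t are non-negative, and each coefficient counts the (finitely many) x with
-- the corresponding exponents.
record IsSum (P : List ℕ → Set) (e : List ℕ → ℤ) (s : List ℕ → ℕ) (F : Series) : Set where
  field
    exponent≥0  : ∀ x → P x → 0ℤ ℤ.≤ e x
    coefficient : ∀ a b → ∃[ xs ]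
                    (Unique xs ×
                     (∀ x → x ∈ xs ⇔ (P x × e x ≡ + a × s x ≡ b)) ×
                     F a b ≡ + length xs)

{-# OPTIONS --safe #-}
-- Both families are coded by the tuples (s₁, …, s_N) with 0 ≤ s_k ≤ N - k.  For
-- odd partitions s_k is the multiplicity of 2k - 1.  For lecture hall partitions
-- write μ with trailing zeros up to length N; μ is reduced exactly when
-- consecutive quotients μ_i / (N-i+1) ≥ μ_{i+1} / (N-i) differ by less than 1.
-- From such a λ of length N-1 and 0 ≤ s < N one obtains a μ of length N by
-- μ₁ = ⌈N λ₁ / (N-1)⌉ + s, keeping λ₁, λ₃, λ₅, … as the entries μ₂, μ₄, μ₆, …, and
-- reflecting each of λ₂, λ₄, … in the middle of the interval that its neighbours
-- leave to it.  Reflection is an involution preserving reducedness, so this is a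
-- bijection, and the rounding terms telescope:
-- |μ|ₐ = |λ|ₐ + s and |μ| = |λ| + 2 |λ|ₐ + s.
-- This is the recursion satisfied by the exponents in the product of the finite
-- geometric series 1 + x + … + x^(N-k), x = t q^(2k-1), because
-- ◇ N k = (N-k+1)(2k-1).
module Submission where

open import Defs
open import Data.Bool using (true; false; _∧_)
open import Data.Bool.Properties using (∧-zeroʳ)
open import Data.Fin using (Fin; toℕ; fromℕ<; zero; suc)
open import Data.Fin.Properties using (toℕ-fromℕ<; toℕ-injective; toℕ<n; toℕ≤pred[n])
open import Data.Integer as ℤ using (ℤ; +_; 0ℤ; 1ℤ)
import Data.Integer.Properties as ℤ
open import Data.Integer.Tactic.RingSolver using (solve-∀)
open import Data.List using (List; []; _∷_; _++_; length; lookup; filter; map; replicate; foldr; tabulate; allFin; cartesianProduct; applyUpTo; _[_]%=_)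
open import Data.List.Membership.Propositional using (_∈_)
open import Data.List.Membership.Propositional.Properties using (∈-allFin; ∈-cartesianProduct⁺; ∈-map∘filter⁻; ∈-map∘filter⁺)
open import Data.List.Properties using (length-++; length-map; length-replicate; length-%=; filter-++; filter-all; filter-none; ++-cancelʳ)
open import Data.List.Relation.Unary.All as All using (All; []; _∷_)
import Data.List.Relation.Unary.All.Properties as All
open import Data.List.Relation.Unary.AllPairs using (AllPairs; []; _∷_)
import Data.List.Relation.Unary.AllPairs.Properties as AllPairs
open import Data.List.Relation.Unary.Any using (here)
open import Data.List.Relation.Unary.Linked using (Linked; []; [-]; _∷_)
import Data.List.Relation.Unary.Linked.Properties as Linked
open import Data.List.Relation.Unary.Unique.Propositional using (Unique)
import Data.List.Relation.Unary.Unique.Propositional.Properties as Unique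
open import Data.Nat using (ℕ; zero; suc; _+_; _*_; _∸_; _≤_; _<_; _≥_; _>_; z≤n; s≤s; _≡ᵇ_; _≟_; _≤?_; NonZero)
open import Data.Nat.DivMod using (_/_; _%_; m≡m%n+[m/n]*n; m%n<n; m<n*o⇒m/o<n; /-monoˡ-≤; m<n⇒m/n≡0; +-distrib-/-∣ʳ; n/n≡1)
open import Data.Nat.Divisibility using (_∣_; _∤_; ∣-refl; ∣m+n∣m⇒∣n; m∣m*n; >⇒∤)
open import Data.Nat.ListAction using (sum)
open import Data.Nat.ListAction.Properties using (sum-++)
open import Data.Nat.Properties
import Data.Nat.Tactic.RingSolver as ℕ-Solver
open import Data.Product using (_×_; _,_; proj₁; proj₂; ∃₂; ∃-syntax)
open import Data.Rational.Unnormalised as ℚᵘ using (*≤*)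
open import Data.Sum using (_⊎_; inj₁; inj₂)
open import Data.Unit using (⊤; tt)
open import Data.Vec using (Vec; []; _∷_; toList)
import Data.Vec.Properties as Vec
open import Function using (_∘_; mk⇔)
open import Relation.Binary.PropositionalEquality
open import Relation.Nullary using (Dec; ¬_; yes; no; contradiction)
open import Relation.Nullary.Decidable using (_×-dec_; dec-true; dec-false)

-- Formal power series

Σ≤-cong : ∀ n {f g : ℕ → ℤ} → (∀ i → f i ≡ g i) → Σ≤ n f ≡ Σ≤ n g
Σ≤-cong zero    f≗g = f≗g 0
Σ≤-cong (suc n) f≗g = cong₂ ℤ._+_ (Σ≤-cong n f≗g) (f≗g (suc n))

Σ≤-+ : ∀ n (f g : ℕ → ℤ) → Σ≤ n (λ i → f i ℤ.+ g i) ≡ Σ≤ n f ℤ.+ Σ≤ n g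
Σ≤-+ zero    f g = refl
Σ≤-+ (suc n) f g = trans (cong (λ x → x ℤ.+ (f (suc n) ℤ.+ g (suc n))) (Σ≤-+ n f g)) (interchange (Σ≤ n f) _ _ _)
  where
  interchange : ∀ a b c d → (a ℤ.+ b) ℤ.+ (c ℤ.+ d) ≡ (a ℤ.+ c) ℤ.+ (b ℤ.+ d)
  interchange = solve-∀

Σ≤-zero : ∀ n {f : ℕ → ℤ} → (∀ i → i ≤ n → f i ≡ 0ℤ) → Σ≤ n f ≡ 0ℤ
Σ≤-zero zero    f≗0 = f≗0 0 z≤n
Σ≤-zero (suc n) f≗0 =
  cong₂ ℤ._+_ (Σ≤-zero n (λ i i≤n → f≗0 i (m≤n⇒m≤1+n i≤n))) (f≗0 (suc n) ≤-refl)

Σ≤-single : ∀ {m n} {f : ℕ → ℤ} → m ≤ n → (∀ i → i ≢ m → f i ≡ 0ℤ) → Σ≤ n f ≡ f m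
Σ≤-single {m} {zero}  z≤n _   = refl
Σ≤-single {m} {suc n} {f} m≤n f≗0 with m≤n⇒m<n∨m≡n m≤n
... | inj₁ (s≤s m≤n′) =
  trans (cong₂ ℤ._+_ (Σ≤-single m≤n′ f≗0) (f≗0 (suc n) λ { refl → 1+n≰n m≤n′ }))
        (ℤ.+-identityʳ (f m))
... | inj₂ refl =
  trans (cong (ℤ._+ f (suc n)) (Σ≤-zero n λ i i≤n → f≗0 i λ { refl → 1+n≰n i≤n }))
        (ℤ.+-identityˡ (f (suc n)))

Σ≤-front : ∀ n (f : ℕ → ℤ) → Σ≤ (suc n) f ≡ f 0 ℤ.+ Σ≤ n (f ∘ suc)
Σ≤-front zero    f = refl
Σ≤-front (suc n) f = trans (cong (ℤ._+ f (2 + n)) (Σ≤-front n f)) (ℤ.+-assoc (f 0) _ _)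

infixl 6 _+ˢ_
_+ˢ_ : Series → Series → Series
(F +ˢ G) a b = F a b ℤ.+ G a b

0ˢ : Series
0ˢ a b = 0ℤ

*ˢ-cong : ∀ {F F′ G G′} → F ≈ˢ F′ → G ≈ˢ G′ → F *ˢ G ≈ˢ F′ *ˢ G′
*ˢ-cong F≈ G≈ a b = Σ≤-cong a λ i → Σ≤-cong b λ j → cong₂ ℤ._*_ (F≈ i j) (G≈ (a ∸ i) (b ∸ j))

*ˢ-distribʳ-+ˢ : ∀ H F G → (F +ˢ G) *ˢ H ≈ˢ F *ˢ H +ˢ G *ˢ H
*ˢ-distribʳ-+ˢ H F G a b =
  trans (Σ≤-cong a λ i → trans (Σ≤-cong b λ j → ℤ.*-distribʳ-+ _ (F i j) (G i j)) (Σ≤-+ b _ _))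
        (Σ≤-+ a _ _)

*ˢ-zeroˡ : ∀ G → 0ˢ *ˢ G ≈ˢ 0ˢ
*ˢ-zeroˡ G a b = Σ≤-zero a λ i _ → Σ≤-zero b λ j _ → refl

-- Reduced to `_+ˢ_`: since `F` is `(F -ˢ G) +ˢ G`, distributivity over the sum gives the claim
-- after subtracting `G *ˢ H`.
*ˢ-distribʳ--ˢ : ∀ H F G → (F -ˢ G) *ˢ H ≈ˢ F *ˢ H -ˢ G *ˢ H
*ˢ-distribʳ--ˢ H F G a b = begin
  ((F -ˢ G) *ˢ H) a b                                           ≡⟨ solution _ _ ⟨
  (((F -ˢ G) *ˢ H) a b ℤ.+ (G *ˢ H) a b) ℤ.- (G *ˢ H) a b       ≡⟨ cong (ℤ._- _) (*ˢ-distribʳ-+ˢ H (F -ˢ G) G a b) ⟨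
  (((F -ˢ G) +ˢ G) *ˢ H) a b ℤ.- (G *ˢ H) a b                   ≡⟨ cong (ℤ._- _) (*ˢ-cong {G = H} (λ i j → cancel (F i j) (G i j)) (λ _ _ → refl) a b) ⟩
  (F *ˢ H -ˢ G *ˢ H) a b                                        ∎
  where
  open ≡-Reasoning
  solution : ∀ x y → (x ℤ.+ y) ℤ.- y ≡ x
  solution = solve-∀
  cancel : ∀ x y → (x ℤ.- y) ℤ.+ y ≡ x
  cancel = solve-∀

-- Multiplication by a monomial

monomial-≡ : ∀ m n → (t^ m q^ n) m n ≡ 1ℤ
monomial-≡ m n rewrite dec-true (m ≟ m) refl | dec-true (n ≟ n) refl = refl

monomial-≢ : ∀ m n a b → a ≢ m ⊎ b ≢ n → (t^ m q^ n) a b ≡ 0ℤ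
monomial-≢ m n a b (inj₁ a≢m) rewrite dec-false (a ≟ m) a≢m = refl
monomial-≢ m n a b (inj₂ b≢n) rewrite dec-false (b ≟ n) b≢n | ∧-zeroʳ (a ≡ᵇ m) = refl

-- Multiplication by `t^ m q^ n` shifts coefficients: `shifted` positions receive a coefficient of
-- the other factor, `outside` positions receive 0.
data View (m n : ℕ) : ℕ → ℕ → Set where
  shifted : ∀ a b → View m n (m + a) (n + b)
  outside : ∀ {a b} → a < m ⊎ b < n → View m n a b

view : ∀ m n a b → View m n a b
view m n a b with m ≤? a | n ≤? b
... | yes m≤a | yes n≤b = subst₂ (View m n) (m+[n∸m]≡n m≤a) (m+[n∸m]≡n n≤b) (shifted _ _)
... | no  m≰a | _       = outside (inj₁ (≰⇒> m≰a))
... | _       | no n≰b  = outside (inj₂ (≰⇒> n≰b))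

monomial-*-shifted : ∀ m n G a b → (t^ m q^ n *ˢ G) (m + a) (n + b) ≡ G a b
monomial-*-shifted m n G a b = begin
  (t^ m q^ n *ˢ G) (m + a) (n + b)
    ≡⟨ Σ≤-single (m≤m+n m a) (λ i i≢m → Σ≤-zero (n + b) λ j _ → cong (ℤ._* G (m + a ∸ i) (n + b ∸ j)) (monomial-≢ m n i j (inj₁ i≢m))) ⟩
  Σ≤ (n + b) (λ j → (t^ m q^ n) m j ℤ.* G (m + a ∸ m) (n + b ∸ j))
    ≡⟨ Σ≤-single (m≤m+n n b) (λ j j≢n → cong (ℤ._* G (m + a ∸ m) (n + b ∸ j)) (monomial-≢ m n m j (inj₂ j≢n))) ⟩
  (t^ m q^ n) m n ℤ.* G (m + a ∸ m) (n + b ∸ n)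
    ≡⟨ cong₂ ℤ._*_ (monomial-≡ m n) (cong₂ G (m+n∸m≡n m a) (m+n∸m≡n n b)) ⟩
  1ℤ ℤ.* G a b
    ≡⟨ ℤ.*-identityˡ _ ⟩
  G a b ∎
  where open ≡-Reasoning

monomial-*-outside : ∀ m n G {a b} → a < m ⊎ b < n → (t^ m q^ n *ˢ G) a b ≡ 0ℤ
monomial-*-outside m n G {a} {b} out =
  Σ≤-zero a λ i i≤a → Σ≤-zero b λ j j≤b → cong (ℤ._* G (a ∸ i) (b ∸ j)) (monomial-≢ m n i j (distinct out i≤a j≤b))
  where
  distinct : ∀ {i j} → a < m ⊎ b < n → i ≤ a → j ≤ b → i ≢ m ⊎ j ≢ n
  distinct (inj₁ a<m) i≤a _ = inj₁ λ { refl → <⇒≱ a<m i≤a }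
  distinct (inj₂ b<n) _ j≤b = inj₂ λ { refl → <⇒≱ b<n j≤b }

≡ᵇ-+ˡ : ∀ m a b → (m + a ≡ᵇ m + b) ≡ (a ≡ᵇ b)
≡ᵇ-+ˡ zero    a b = refl
≡ᵇ-+ˡ (suc m) a b = ≡ᵇ-+ˡ m a b

monomial-shift : ∀ m n m′ n′ a b → (t^ (m + m′) q^ (n + n′)) (m + a) (n + b) ≡ (t^ m′ q^ n′) a b
monomial-shift m n m′ n′ a b rewrite ≡ᵇ-+ˡ m a m′ | ≡ᵇ-+ˡ n b n′ = refl

monomial-shift-outside : ∀ {m n a b} m′ n′ → a < m ⊎ b < n → (t^ (m + m′) q^ (n + n′)) a b ≡ 0ℤ
monomial-shift-outside {m} {n} {a} {b} m′ n′ out = monomial-≢ (m + m′) (n + n′) a b (distinct out)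
  where
  distinct : a < m ⊎ b < n → a ≢ m + m′ ⊎ b ≢ n + n′
  distinct (inj₁ a<m) = inj₁ (<⇒≢ (m≤n⇒m≤n+o m′ a<m))
  distinct (inj₂ b<n) = inj₂ (<⇒≢ (m≤n⇒m≤n+o n′ b<n))

-- Generating functions of finite lists

module _ {C : Set} where

  gf : (C → ℕ) → (C → ℕ) → List C → Series
  gf e s []       = 0ˢ
  gf e s (c ∷ cs) = t^ e c q^ s c +ˢ gf e s cs

  gf-++ : ∀ e s cs ds → gf e s (cs ++ ds) ≈ˢ gf e s cs +ˢ gf e s ds
  gf-++ e s []       ds a b = sym (ℤ.+-identityˡ _)
  gf-++ e s (c ∷ cs) ds a b = 
    trans (cong (λ x → (t^ e c q^ s c) a b ℤ.+ x) (gf-++ e s cs ds a b))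
          (sym (ℤ.+-assoc ((t^ e c q^ s c) a b) (gf e s cs a b) (gf e s ds a b)))

  gf-count : ∀ e s cs a b → gf e s cs a b ≡ + length (filter (λ c → (a ≟ e c) ×-dec (b ≟ s c)) cs)
  gf-count e s []       a b = refl
  -- This Boolean is both the condition in `t^_q^_` and the `does` field of the decision used by
  -- `filter`, so both sides reduce together.
  gf-count e s (c ∷ cs) a b with (a ≡ᵇ e c) ∧ (b ≡ᵇ s c) | gf-count e s cs a b
  ... | true  | eq = cong (λ x → 1ℤ ℤ.+ x) eq
  ... | false | eq = trans (ℤ.+-identityˡ _) eq

gf-cong : ∀ {C : Set} {e e′ s s′ : C → ℕ} → (∀ c → e c ≡ e′ c) → (∀ c → s c ≡ s′ c) →
          ∀ cs → gf e s cs ≈ˢ gf e′ s′ cs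
gf-cong e≗ s≗ []       a b = refl
gf-cong e≗ s≗ (c ∷ cs) a b =
  cong₂ ℤ._+_ (cong₂ (λ m n → (t^ m q^ n) a b) (e≗ c) (s≗ c)) (gf-cong e≗ s≗ cs a b)

-- Induction on the first list: multiplying by the monomial of `c` shifts the generating function of
-- `ds`, which is the row of all pairs with first component `c`.
gf-× : ∀ {C D : Set} (e s : C → ℕ) (e′ s′ : D → ℕ) cs ds →
       gf e s cs *ˢ gf e′ s′ ds ≈ˢ
       gf (λ (c , d) → e c + e′ d) (λ (c , d) → s c + s′ d) (cartesianProduct cs ds)
gf-× {C} {D} e s e′ s′ []       ds a b = *ˢ-zeroˡ (gf e′ s′ ds) a b
gf-× {C} {D} e s e′ s′ (c ∷ cs) ds a b = begin
  ((t^ e c q^ s c +ˢ gf e s cs) *ˢ gf e′ s′ ds) a b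
    ≡⟨ *ˢ-distribʳ-+ˢ (gf e′ s′ ds) (t^ e c q^ s c) (gf e s cs) a b ⟩
  (t^ e c q^ s c *ˢ gf e′ s′ ds) a b ℤ.+ (gf e s cs *ˢ gf e′ s′ ds) a b
    ≡⟨ cong₂ ℤ._+_ (row ds (view (e c) (s c) a b)) (gf-× e s e′ s′ cs ds a b) ⟩
  gf E S (map (c ,_) ds) a b ℤ.+ gf E S (cartesianProduct cs ds) a b
    ≡⟨ gf-++ E S (map (c ,_) ds) (cartesianProduct cs ds) a b ⟨
  gf E S (cartesianProduct (c ∷ cs) ds) a b ∎
  where
  open ≡-Reasoning
  E S : C × D → ℕ
  E (c , d) = e c + e′ d
  S (c , d) = s c + s′ d
  gf-shift : ∀ ds a b → gf E S (map (c ,_) ds) (e c + a) (s c + b) ≡ gf e′ s′ ds a b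
  gf-shift []       a b = refl
  gf-shift (d ∷ ds) a b = cong₂ ℤ._+_ (monomial-shift (e c) (s c) (e′ d) (s′ d) a b) (gf-shift ds a b)
  gf-outside : ∀ ds {a b} → a < e c ⊎ b < s c → gf E S (map (c ,_) ds) a b ≡ 0ℤ
  gf-outside []       out = refl
  gf-outside (d ∷ ds) out = cong₂ ℤ._+_ (monomial-shift-outside (e′ d) (s′ d) out) (gf-outside ds out)
  row : ∀ ds {a b} → View (e c) (s c) a b → (t^ e c q^ s c *ˢ gf e′ s′ ds) a b ≡ gf E S (map (c ,_) ds) a b
  row ds (shifted a b) = trans (monomial-*-shifted (e c) (s c) (gf e′ s′ ds) a b) (sym (gf-shift ds a b))
  row ds (outside out) = trans (monomial-*-outside (e c) (s c) (gf e′ s′ ds) out) (sym (gf-outside ds out))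

-- The family `φ` is arbitrary so that the induction can replace `f` and `φ` by their shifts along
-- `suc`, matching `Σ≤-front`.
gf-tabulate : ∀ {C : Set} (e s : C → ℕ) {n} (f : Fin (suc n) → C) (φ : ℕ → ℕ → ℕ → ℤ) →
              (∀ j a b → (t^ e (f j) q^ s (f j)) a b ≡ φ (toℕ j) a b) →
              ∀ a b → gf e s (tabulate f) a b ≡ Σ≤ n (λ j → φ j a b)
gf-tabulate e s {zero}  f φ eq a b = trans (ℤ.+-identityʳ _) (eq zero a b)
gf-tabulate e s {suc n} f φ eq a b =
  trans (cong₂ ℤ._+_ (eq zero a b) (gf-tabulate e s (f ∘ suc) (φ ∘ suc) (eq ∘ suc) a b))
        (sym (Σ≤-front n (λ j → φ j a b)))

-- Geometric series

^ˢ-cong : ∀ {F G} j → F ≈ˢ G → F ^ˢ j ≈ˢ G ^ˢ j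
^ˢ-cong zero    F≈G a b = refl
^ˢ-cong (suc j) F≈G = *ˢ-cong F≈G (^ˢ-cong j F≈G)

monomial-^ : ∀ m n j → (t^ m q^ n) ^ˢ j ≈ˢ t^ (j * m) q^ (j * n)
monomial-^ m n zero    a b = refl
monomial-^ m n (suc j) a b = trans (*ˢ-cong {t^ m q^ n} {G = (t^ m q^ n) ^ˢ j} (λ _ _ → refl) (monomial-^ m n j) a b) (shift (view m n a b))
  where
  shift : ∀ {a b} → View m n a b → (t^ m q^ n *ˢ t^ (j * m) q^ (j * n)) a b ≡ (t^ (suc j * m) q^ (suc j * n)) a b
  shift (shifted a b) = trans (monomial-*-shifted m n (t^ (j * m) q^ (j * n)) a b) (sym (monomial-shift m n (j * m) (j * n) a b))
  shift (outside out) = trans (monomial-*-outside m n (t^ (j * m) q^ (j * n)) out) (sym (monomial-shift-outside (j * m) (j * n) out))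

-- The j-th term of the inverse is the power of `t^ 1 q^ s` with exponent j, and only j = `a` has
-- the right degree in t. As `a ≤ a + b`, the truncation keeps that term.
geometric : ∀ s a b → inverse (1ˢ -ˢ t^ 1 q^ s) a b ≡ (t^ a q^ (a * s)) a b
geometric s a b = begin
  Σ≤ (a + b) (λ j → ((1ˢ -ˢ (1ˢ -ˢ t^ 1 q^ s)) ^ˢ j) a b)
    ≡⟨ Σ≤-cong (a + b) (λ j → trans (^ˢ-cong j (λ i k → cancel (1ˢ i k) _) a b) (monomial-^ 1 s j a b)) ⟩
  Σ≤ (a + b) (λ j → (t^ (j * 1) q^ (j * s)) a b)
    ≡⟨ Σ≤-single (m≤m+n a b) (λ j j≢a → monomial-≢ (j * 1) (j * s) a b (inj₁ λ a≡j → j≢a (sym (trans a≡j (*-identityʳ j))))) ⟩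
  (t^ (a * 1) q^ (a * s)) a b
    ≡⟨ cong (λ m → (t^ m q^ (a * s)) a b) (*-identityʳ a) ⟩
  (t^ a q^ (a * s)) a b ∎
  where
  open ≡-Reasoning
  cancel : ∀ x y → x ℤ.- (x ℤ.- y) ≡ y
  cancel = solve-∀

-- With x = t q^s, subtracting x^M / (1 - x) from 1 / (1 - x) cancels exactly the powers of exponent
-- at least M = `suc m`. The coefficients are compared according to whether the shift by x^M reaches
-- them.
finite-geometric : ∀ m s → (1ˢ -ˢ t^ (suc m) q^ (suc m * s)) /ˢ (1ˢ -ˢ t^ 1 q^ s) ≈ˢ
                   gf {Fin (suc m)} toℕ (λ j → toℕ j * s) (allFin (suc m))
finite-geometric m s a b = begin
  ((1ˢ -ˢ t^ M q^ (M * s)) *ˢ I) a b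
    ≡⟨ *ˢ-distribʳ--ˢ I 1ˢ (t^ M q^ (M * s)) a b ⟩
  (1ˢ *ˢ I) a b ℤ.- (t^ M q^ (M * s) *ˢ I) a b
    ≡⟨ cong (ℤ._- (t^ M q^ (M * s) *ˢ I) a b) (trans (monomial-*-shifted 0 0 I a b) (geometric s a b)) ⟩
  (t^ a q^ (a * s)) a b ℤ.- (t^ M q^ (M * s) *ˢ I) a b
    ≡⟨ truncate (view M (M * s) a b) ⟩
  Σ≤ m (λ j → (t^ j q^ (j * s)) a b)
    ≡⟨ gf-tabulate toℕ (λ j → toℕ j * s) {m} (λ j → j) (λ j → t^ j q^ (j * s)) (λ _ _ _ → refl) a b ⟨
  gf toℕ (λ j → toℕ j * s) (allFin M) a b ∎
  where
  open ≡-Reasoning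
  M = suc m
  I = inverse (1ˢ -ˢ t^ 1 q^ s)

  large : ∀ {a} b → M ≤ a → Σ≤ m (λ j → (t^ j q^ (j * s)) a b) ≡ 0ℤ
  large {a} b M≤a = Σ≤-zero m λ j j≤m → monomial-≢ j (j * s) a b (inj₁ λ { refl → <⇒≱ M≤a j≤m })

  truncate : ∀ {a b} → View M (M * s) a b →
             (t^ a q^ (a * s)) a b ℤ.- (t^ M q^ (M * s) *ˢ I) a b ≡ Σ≤ m (λ j → (t^ j q^ (j * s)) a b)
  truncate (shifted a b) = begin
    (t^ (M + a) q^ ((M + a) * s)) (M + a) (M * s + b) ℤ.- (t^ M q^ (M * s) *ˢ I) (M + a) (M * s + b)
      ≡⟨ cong₂ ℤ._-_ (trans (cong (λ n → (t^ (M + a) q^ n) (M + a) (M * s + b)) (*-distribʳ-+ s M a))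
                            (monomial-shift M (M * s) a (a * s) a b))
                     (trans (monomial-*-shifted M (M * s) I a b) (geometric s a b)) ⟩
    (t^ a q^ (a * s)) a b ℤ.- (t^ a q^ (a * s)) a b
      ≡⟨ ℤ.+-inverseʳ ((t^ a q^ (a * s)) a b) ⟩
    0ℤ
      ≡⟨ large (M * s + b) (m≤m+n M a) ⟨
    Σ≤ m (λ j → (t^ j q^ (j * s)) (M + a) (M * s + b)) ∎
  truncate {a} {b} (outside out) = begin
    (t^ a q^ (a * s)) a b ℤ.- (t^ M q^ (M * s) *ˢ I) a b
      ≡⟨ cong (λ x → (t^ a q^ (a * s)) a b ℤ.- x) (monomial-*-outside M (M * s) I out) ⟩
    (t^ a q^ (a * s)) a b ℤ.- 0ℤ
      ≡⟨ ℤ.+-identityʳ _ ⟩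
    (t^ a q^ (a * s)) a b
      ≡⟨ inside out ⟩
    Σ≤ m (λ j → (t^ j q^ (j * s)) a b) ∎
    where
    inside′ : a ≤ m → (t^ a q^ (a * s)) a b ≡ Σ≤ m (λ j → (t^ j q^ (j * s)) a b)
    inside′ a≤m = sym (Σ≤-single a≤m λ j j≢a → monomial-≢ j (j * s) a b (inj₁ (≢-sym j≢a)))
    inside : a < M ⊎ b < M * s → (t^ a q^ (a * s)) a b ≡ Σ≤ m (λ j → (t^ j q^ (j * s)) a b)
    inside (inj₁ (s≤s a≤m)) = inside′ a≤m
    -- If `M ≤ a`, then `b < M * s ≤ a * s`, so the coefficient is 0, and so is the sum, whose
    -- exponents of t stay below `a`.
    inside (inj₂ b<Ms) with M ≤? a
    ... | yes M≤a = trans (monomial-≢ a (a * s) a b (inj₂ (<⇒≢ (≤-trans b<Ms (*-monoˡ-≤ s M≤a))))) (sym (large b M≤a))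
    ... | no  M≰a = inside′ (≤-pred (≰⇒> M≰a))

-- Lecture hall partitions

hd : List ℕ → ℕ
hd []      = 0
hd (x ∷ _) = x

tl : List ℕ → List ℕ
tl []       = []
tl (_ ∷ xs) = xs

-- ⌈ z / n ⌉, with value 0 for n = 0
⌈_/_⌉ : ℕ → ℕ → ℕ
⌈ z / zero  ⌉ = 0
⌈ z / suc n ⌉ = (z + n) / suc n

-- With `≤-⌈/⌉` this characterizes the ceiling as the least `k` such that `z ≤ k * suc n`.
⌈/⌉-≤ : ∀ {z k n} → z ≤ k * suc n → ⌈ z / suc n ⌉ ≤ k
⌈/⌉-≤ {z} {k} {n} z≤ = ≤-pred (m<n*o⇒m/o<n (s≤s (begin
  z + n           ≤⟨ +-monoˡ-≤ n z≤ ⟩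
  k * suc n + n   ≡⟨ +-comm (k * suc n) n ⟩
  n + k * suc n   ∎)))
  where open ≤-Reasoning

≤-⌈/⌉ : ∀ z n → z ≤ ⌈ z / suc n ⌉ * suc n
≤-⌈/⌉ z n = +-cancelʳ-≤ n z _ (begin
  z + n                                           ≡⟨ m≡m%n+[m/n]*n (z + n) (suc n) ⟩
  (z + n) % suc n + ⌈ z / suc n ⌉ * suc n         ≤⟨ +-monoˡ-≤ _ (≤-pred (m%n<n (z + n) (suc n))) ⟩
  n + ⌈ z / suc n ⌉ * suc n                       ≡⟨ +-comm n _ ⟩
  ⌈ z / suc n ⌉ * suc n + n                       ∎)
  where open ≤-Reasoning

⌈/⌉-self : ∀ y n → ⌈ y / suc n ⌉ ≤ y
⌈/⌉-self y n = ⌈/⌉-≤ (m≤m*n y (suc n))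

-- ceil n z = ⌈ z (n+1) / n ⌉ is the least entry allowed before an entry z with
-- denominator n, and floor n y = ⌊ y n / (n+1) ⌋ the greatest entry allowed
-- after an entry y with denominator n+1.
ceil : ℕ → ℕ → ℕ
ceil n z = z + ⌈ z / n ⌉

floor : ℕ → ℕ → ℕ
floor n y = y ∸ ⌈ y / suc n ⌉

ceil-zero : ∀ n → ceil n 0 ≡ 0
ceil-zero zero    = refl
ceil-zero (suc n) = m<n⇒m/n≡0 (n<1+n n)

ceil-mono : ∀ n {y z} → y ≤ z → ceil n y ≤ ceil n z
ceil-mono zero    y≤z = +-monoˡ-≤ 0 y≤z
ceil-mono (suc n) y≤z = +-mono-≤ y≤z (/-monoˡ-≤ (suc n) (+-monoˡ-≤ n y≤z))

-- Raising `z` by its denominator raises the quotient by 1. This turns bounds on a difference of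
-- quotients into plain comparisons of quotients.
ceil-shift : ∀ n z → ceil (suc n) (z + suc n) ≡ ceil (suc n) z + suc (suc n)
ceil-shift n z = begin
  (z + suc n) + (z + suc n + n) / suc n             ≡⟨ cong (λ u → z + suc n + u / suc n) (swap z n) ⟩
  (z + suc n) + (z + n + suc n) / suc n             ≡⟨ cong (λ u → z + suc n + u) (+-distrib-/-∣ʳ (z + n) ∣-refl) ⟩
  (z + suc n) + (⌈ z / suc n ⌉ + suc n / suc n)     ≡⟨ cong (λ u → z + suc n + (⌈ z / suc n ⌉ + u)) (n/n≡1 (suc n)) ⟩
  (z + suc n) + (⌈ z / suc n ⌉ + 1)                 ≡⟨ regroup z n ⌈ z / suc n ⌉ ⟩
  z + ⌈ z / suc n ⌉ + suc (suc n)                   ∎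
  where
  open ≡-Reasoning
  swap : ∀ z n → z + suc n + n ≡ z + n + suc n
  swap = ℕ-Solver.solve-∀
  regroup : ∀ z n u → (z + suc n) + (u + 1) ≡ z + u + suc (suc n)
  regroup = ℕ-Solver.solve-∀

-- The same rounding term `⌈ y / suc n ⌉` is added in `ceil` and subtracted in `floor`.
ceil+floor : ∀ n y → ceil (suc n) y + floor n y ≡ y + y
ceil+floor n y = trans (+-assoc y _ _) (cong (λ u → y + u) (m+[n∸m]≡n (⌈/⌉-self y n)))

-- The condition y / (n+1) ≥ z / n without denominators.
slope-difference : ∀ {n y z} → z * suc (suc n) ≤ y * suc n → ∃[ d ] y ≡ z + d × z ≤ d * suc n
slope-difference {n} {y} {z} slope = y ∸ z , sym (m+[n∸m]≡n z≤y) , +-cancelʳ-≤ (z * suc n) z _ (begin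
  z + z * suc n                        ≡⟨ *-suc z (suc n) ⟨
  z * suc (suc n)                      ≤⟨ slope ⟩
  y * suc n                            ≡⟨ cong (_* suc n) (m∸n+n≡m z≤y) ⟨
  (y ∸ z + z) * suc n                  ≡⟨ *-distribʳ-+ (suc n) (y ∸ z) z ⟩
  (y ∸ z) * suc n + z * suc n          ∎)
  where
  open ≤-Reasoning
  z≤y : z ≤ y
  z≤y = *-cancelʳ-≤ z y (suc n) (≤-trans (*-monoʳ-≤ z (n≤1+n (suc n))) slope)

slope⇒ceil : ∀ {n y z} → z * suc (suc n) ≤ y * suc n → ceil (suc n) z ≤ y
slope⇒ceil {n} {y} {z} slope with slope-difference {n} {y} {z} slope
... | d , refl , z≤ = +-monoʳ-≤ z (⌈/⌉-≤ z≤)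

slope⇒floor : ∀ {n y z} → z * suc (suc n) ≤ y * suc n → z ≤ floor (suc n) y
slope⇒floor {n} {y} {z} slope with slope-difference {n} {y} {z} slope
... | d , refl , z≤ = m+n≤o⇒m≤o∸n z (+-monoʳ-≤ z (⌈/⌉-≤ (begin
  z + d              ≤⟨ +-monoˡ-≤ d z≤ ⟩
  d * suc n + d      ≡⟨ +-comm (d * suc n) d ⟩
  d + d * suc n      ≡⟨ *-suc d (suc n) ⟨
  d * suc (suc n)    ∎)))
  where open ≤-Reasoning

ceil⇒slope : ∀ {n y z} → ceil (suc n) z ≤ y → z * suc (suc n) ≤ y * suc n
ceil⇒slope {n} {y} {z} ceil≤y = begin
  z * suc (suc n)                          ≡⟨ *-suc z (suc n) ⟩
  z + z * suc n                            ≤⟨ +-monoˡ-≤ (z * suc n) (≤-⌈/⌉ z n) ⟩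
  ⌈ z / suc n ⌉ * suc n + z * suc n        ≡⟨ +-comm _ (z * suc n) ⟩
  z * suc n + ⌈ z / suc n ⌉ * suc n        ≡⟨ *-distribʳ-+ (suc n) z _ ⟨
  ceil (suc n) z * suc n                   ≤⟨ *-monoˡ-≤ (suc n) ceil≤y ⟩
  y * suc n                                ∎
  where open ≤-Reasoning

floor⇒slope : ∀ {n y z} → z ≤ floor (suc n) y → z * suc (suc n) ≤ y * suc n
floor⇒slope {n} {y} {z} z≤floor = +-cancelʳ-≤ y _ _ (begin
  z * suc (suc n) + y                             ≤⟨ +-monoʳ-≤ _ (≤-⌈/⌉ y (suc n)) ⟩
  z * suc (suc n) + u * suc (suc n)               ≡⟨ *-distribʳ-+ (suc (suc n)) z u ⟨
  (z + u) * suc (suc n)                           ≤⟨ *-monoˡ-≤ (suc (suc n)) (m≤o∸n⇒m+n≤o z (⌈/⌉-self y (suc n)) z≤floor) ⟩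
  y * suc (suc n)                                 ≡⟨ *-suc y (suc n) ⟩
  y + y * suc n                                   ≡⟨ +-comm y _ ⟩
  y * suc n + y                                   ∎)
  where
  open ≤-Reasoning
  u = ⌈ y / suc (suc n) ⌉

-- Both sides are the same inequality of quotients; with the converse below, `ceil (suc n)` and
-- `floor (suc n)` form a Galois connection.
ceil≤⇒≤floor : ∀ {n y z} → ceil (suc n) z ≤ y → z ≤ floor (suc n) y
ceil≤⇒≤floor {n} {y} {z} = slope⇒floor {n} {y} {z} ∘ ceil⇒slope {n} {y} {z}

≤floor⇒ceil≤ : ∀ {n y z} → z ≤ floor (suc n) y → ceil (suc n) z ≤ y
≤floor⇒ceil≤ {n} {y} {z} = slope⇒ceil {n} {y} {z} ∘ floor⇒slope {n} {y} {z}

-- The contrapositive of the Galois connection at `z + suc n`, rewritten by `ceil-shift`.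
<ceil⇒floor< : ∀ {n y z} → y < ceil (suc n) z + suc (suc n) → floor (suc n) y < z + suc n
<ceil⇒floor< {n} {y} {z} y< =
  ≰⇒> λ z+n≤ → <⇒≱ y< (subst (_≤ y) (ceil-shift n z) (≤floor⇒ceil≤ {n} {y} {z + suc n} z+n≤))

floor<⇒<ceil : ∀ {n y z} → floor (suc n) y < z + suc n → y < ceil (suc n) z + suc (suc n)
floor<⇒<ceil {n} {y} {z} f< =
  ≰⇒> λ c≤ → <⇒≱ f< (ceil≤⇒≤floor {n} {y} {z + suc n} (subst (_≤ y) (sym (ceil-shift n z)) c≤))

data Slopes : ℕ → List ℕ → Set where
  []  : ∀ {n} → Slopes n []
  _∷_ : ∀ {n x xs} → ceil n (hd xs) ≤ x → Slopes n xs → Slopes (suc n) (x ∷ xs)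

-- Consecutive quotients, padded with zeros, differ by less than 1.
data Tight : ℕ → List ℕ → Set where
  []  : ∀ {n} → Tight n []
  _∷_ : ∀ {n x xs} → ceil n (hd xs) ≤ x × x < ceil n (hd xs) + suc n →
        Tight n xs → Tight (suc n) (x ∷ xs)

tight⇒slopes : ∀ {n xs} → Tight n xs → Slopes n xs
tight⇒slopes []            = []
tight⇒slopes ((l , _) ∷ t) = l ∷ tight⇒slopes t

slopes⇒length≤ : ∀ {n xs} → Slopes n xs → length xs ≤ n
slopes⇒length≤ []      = z≤n
slopes⇒length≤ (_ ∷ s) = s≤s (slopes⇒length≤ s)

-- Reflection of every second entry

reflect : ∀ {n} → Vec ℕ n → Vec ℕ n
reflect []       = []
reflect (y ∷ []) = y ∷ []
reflect {suc (suc n)} (y ∷ z ∷ v) =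
  y ∷ (floor (suc n) y + ceil n (hd (toList v)) ∸ z) ∷ reflect v

hd-reflect : ∀ {n} (v : Vec ℕ n) → hd (toList (reflect v)) ≡ hd (toList v)
hd-reflect []          = refl
hd-reflect (_ ∷ [])    = refl
hd-reflect (_ ∷ _ ∷ _) = refl

-- Reflecting z in the middle of [C, F] exchanges the constraints C ≤ z and
-- z ≤ F, as well as z < C + k and F < z + k.
record Reflected (C F k z z′ : ℕ) : Set where
  field
    C≤z′  : C ≤ z′
    z′<   : z′ < C + k
    z′≤F  : z′ ≤ F
    F<    : F < z′ + k
    total : z + z′ ≡ F + C

-- Write `z = C + d` and `F = C + d + e`. The reflected value is then `C + e`, so reflection swaps
-- `d` and `e`, and both strict bounds say that one of them is less than `k`.
reflected : ∀ {C F k z} → C ≤ z → z < C + k → z ≤ F → F < z + k → Reflected C F k z (F + C ∸ z)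
reflected {C} {k = k} C≤z z< z≤F F< with m≤n⇒∃[o]m+o≡n C≤z | m≤n⇒∃[o]m+o≡n z≤F
... | d , refl | e , refl = subst (Reflected C (C + d + e) k (C + d)) (sym z′≡) record
  { C≤z′  = m≤m+n C e
  ; z′<   = +-monoʳ-< C (+-cancelˡ-< (C + d) e k F<)
  ; z′≤F  = ≤-trans (m≤m+n (C + e) d) (≤-reflexive (swap C e d))
  ; F<    = subst (_< C + e + k) (swap C e d) (+-monoʳ-< (C + e) (+-cancelˡ-< C d k z<))
  ; total = total′ C d e
  }
  where
  swap : ∀ C e d → C + e + d ≡ C + d + e
  swap = ℕ-Solver.solve-∀
  total′ : ∀ C d e → C + d + (C + e) ≡ C + d + e + C
  total′ = ℕ-Solver.solve-∀
  z′≡ : C + d + e + C ∸ (C + d) ≡ C + e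
  z′≡ = trans (cong (_∸ (C + d)) (sym (total′ C d e))) (m+n∸m≡n (C + d) (C + e))

reflected-tight : ∀ {n y z} {v : Vec ℕ n} → Tight (suc (suc n)) (toList (y ∷ z ∷ v)) →
  Reflected (ceil n (hd (toList v))) (floor (suc n) y) (suc n) z
            (floor (suc n) y + ceil n (hd (toList v)) ∸ z)
reflected-tight {n} {y} {z} ((l , u) ∷ (l′ , u′) ∷ _) =
  reflected l′ u′ (ceil≤⇒≤floor {n} {y} {z} l) (<ceil⇒floor< {n} {y} {z} u)

-- The Galois connection turns the conditions between `y` and `z` into conditions between
-- `floor (suc n) y` and `z`. Reflection trades these for the conditions between `z` and its
-- successor, and the result is translated back.
reflect-tight : ∀ {n} (v : Vec ℕ n) → Tight n (toList v) → Tight n (toList (reflect v))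
reflect-tight []       t = t
reflect-tight (_ ∷ []) t = t
reflect-tight {suc (suc n)} (y ∷ z ∷ v) t@(_ ∷ _ ∷ t″) =
  (≤floor⇒ceil≤ {n} {y} z′≤F , floor<⇒<ceil {n} {y} F<) ∷
  subst (λ h → ceil n h ≤ z′ × z′ < ceil n h + suc n) (sym (hd-reflect v)) (C≤z′ , z′<) ∷
  reflect-tight v t″
  where
  z′ = floor (suc n) y + ceil n (hd (toList v)) ∸ z
  open Reflected (reflected-tight {v = v} t)

-- Both neighbours of a reflected entry are kept, so the second reflection uses the same interval,
-- and `total` recovers `z`.
reflect-involutive : ∀ {n} (v : Vec ℕ n) → Tight n (toList v) → reflect (reflect v) ≡ v
reflect-involutive []       t = refl
reflect-involutive (_ ∷ []) t = refl
reflect-involutive {suc (suc n)} (y ∷ z ∷ v) t@(_ ∷ _ ∷ t″) =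
  cong₂ (λ u w → y ∷ u ∷ w) z″≡z (reflect-involutive v t″)
  where
  z′ = floor (suc n) y + ceil n (hd (toList v)) ∸ z
  open Reflected (reflected-tight {v = v} t)
  z″≡z : floor (suc n) y + ceil n (hd (toList (reflect v))) ∸ z′ ≡ z
  z″≡z = begin
    floor (suc n) y + ceil n (hd (toList (reflect v))) ∸ z′  ≡⟨ cong (λ h → floor (suc n) y + ceil n h ∸ z′) (hd-reflect v) ⟩
    floor (suc n) y + ceil n (hd (toList v)) ∸ z′            ≡⟨ cong (_∸ z′) total ⟨
    z + z′ ∸ z′                                              ≡⟨ m+n∸n≡m z z′ ⟩
    z                                                        ∎
    where open ≡-Reasoning

-- Let F and C be the ends of the interval for `z` and K = `ceil (suc (suc n)) y`. A pair `y`, `z`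
-- contributes 2y - (z + z′) = (K + F) - (F + C) = K - C, and these differences telescope.
altSize-reflect : ∀ {n} (v : Vec ℕ n) → Tight n (toList v) →
  altSize (toList (reflect v)) ℤ.+ altSize (toList v) ≡ + ceil n (hd (toList v))
altSize-reflect []            t = refl
altSize-reflect (zero ∷ [])   t = refl
-- An entry with denominator 1 is less than 1 by tightness, hence 0.
altSize-reflect (suc x ∷ [])  ((_ , s≤s ()) ∷ _)
altSize-reflect {suc (suc n)} (y ∷ z ∷ v) t@(_ ∷ _ ∷ t″) =
  combine (+ y) (+ z) (+ z′) (+ floor (suc n) y) (+ ceil n (hd (toList v))) (+ ceil (suc (suc n)) y)
    (altSize (toList (reflect v))) (altSize (toList v))
    (cong +_ total) (cong +_ (ceil+floor (suc n) y)) (altSize-reflect v t″)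
  where
  z′ = floor (suc n) y + ceil n (hd (toList v)) ∸ z
  open Reflected (reflected-tight {v = v} t)
  combine : ∀ y z z′ F C K a′ a → z ℤ.+ z′ ≡ F ℤ.+ C → K ℤ.+ F ≡ y ℤ.+ y → a′ ℤ.+ a ≡ C →
            (y ℤ.- (z′ ℤ.- a′)) ℤ.+ (y ℤ.- (z ℤ.- a)) ≡ K
  combine y z z′ F C K a′ a e₁ e₂ e₃ = begin
    (y ℤ.- (z′ ℤ.- a′)) ℤ.+ (y ℤ.- (z ℤ.- a))      ≡⟨ collect y z z′ a a′ ⟩
    (y ℤ.+ y) ℤ.- (z ℤ.+ z′) ℤ.+ (a′ ℤ.+ a)        ≡⟨ cong₂ ℤ._+_ (cong₂ ℤ._-_ (sym e₂) e₁) e₃ ⟩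
    (K ℤ.+ F) ℤ.- (F ℤ.+ C) ℤ.+ C                  ≡⟨ cancel K F C ⟩
    K                                              ∎
    where
    open ≡-Reasoning
    collect : ∀ y z z′ a a′ → (y ℤ.- (z′ ℤ.- a′)) ℤ.+ (y ℤ.- (z ℤ.- a)) ≡ (y ℤ.+ y) ℤ.- (z ℤ.+ z′) ℤ.+ (a′ ℤ.+ a)
    collect = solve-∀
    cancel : ∀ K F C → (K ℤ.+ F) ℤ.- (F ℤ.+ C) ℤ.+ C ≡ K
    cancel = solve-∀

-- The same telescoping: for one pair, K - C + z′ = 2y - z = z + 2(y - z).
sum-reflect : ∀ {n} (v : Vec ℕ n) → Tight n (toList v) →
  + ceil n (hd (toList v)) ℤ.+ + sum (toList (reflect v)) ≡
  + sum (toList v) ℤ.+ + 2 ℤ.* altSize (toList v)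
sum-reflect []            t = refl
sum-reflect (zero ∷ [])   t = refl
sum-reflect (suc x ∷ [])  ((_ , s≤s ()) ∷ _)
sum-reflect {suc (suc n)} (y ∷ z ∷ v) t@(_ ∷ _ ∷ t″) =
  combine (+ y) (+ z) (+ z′) (+ floor (suc n) y) (+ ceil n (hd (toList v))) (+ ceil (suc (suc n)) y)
    (+ sum (toList (reflect v))) (+ sum (toList v)) (altSize (toList v))
    (cong +_ total) (cong +_ (ceil+floor (suc n) y)) (sum-reflect v t″)
  where
  z′ = floor (suc n) y + ceil n (hd (toList v)) ∸ z
  open Reflected (reflected-tight {v = v} t)
  combine : ∀ y z z′ F C K S′ S a → z ℤ.+ z′ ≡ F ℤ.+ C → K ℤ.+ F ≡ y ℤ.+ y → C ℤ.+ S′ ≡ S ℤ.+ + 2 ℤ.* a →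
            K ℤ.+ (y ℤ.+ (z′ ℤ.+ S′)) ≡ (y ℤ.+ (z ℤ.+ S)) ℤ.+ + 2 ℤ.* (y ℤ.- (z ℤ.- a))
  combine y z z′ F C K S′ S a e₁ e₂ e₃ = begin
    K ℤ.+ (y ℤ.+ (z′ ℤ.+ S′))
      ≡⟨ collect y z z′ F C K S′ ⟩
    (K ℤ.+ F) ℤ.+ (z ℤ.+ z′) ℤ.- (F ℤ.+ C) ℤ.+ (C ℤ.+ S′) ℤ.+ (y ℤ.- z)
      ≡⟨ cong (ℤ._+ (y ℤ.- z)) (cong₂ ℤ._+_ (cong (ℤ._- (F ℤ.+ C)) (cong₂ ℤ._+_ e₂ e₁)) e₃) ⟩
    (y ℤ.+ y) ℤ.+ (F ℤ.+ C) ℤ.- (F ℤ.+ C) ℤ.+ (S ℤ.+ + 2 ℤ.* a) ℤ.+ (y ℤ.- z)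
      ≡⟨ cancel y z (F ℤ.+ C) S a ⟩
    (y ℤ.+ (z ℤ.+ S)) ℤ.+ + 2 ℤ.* (y ℤ.- (z ℤ.- a)) ∎
    where
    open ≡-Reasoning
    collect : ∀ y z z′ F C K S′ → K ℤ.+ (y ℤ.+ (z′ ℤ.+ S′)) ≡
              (K ℤ.+ F) ℤ.+ (z ℤ.+ z′) ℤ.- (F ℤ.+ C) ℤ.+ (C ℤ.+ S′) ℤ.+ (y ℤ.- z)
    collect = solve-∀
    cancel : ∀ y z D S a → (y ℤ.+ y) ℤ.+ D ℤ.- D ℤ.+ (S ℤ.+ + 2 ℤ.* a) ℤ.+ (y ℤ.- z) ≡
             (y ℤ.+ (z ℤ.+ S)) ℤ.+ + 2 ℤ.* (y ℤ.- (z ℤ.- a))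
    cancel = solve-∀

-- Coding tight sequences

Code : ℕ → Set
Code zero    = ⊤
Code (suc n) = Fin (suc n) × Code n

-- For the tuple (s₁, ..., s_n) these are the sums of s_k and of (2k-1) s_k. Removing s₁ lowers
-- every remaining index by 1 and each weight 2k-1 by 2, hence the summand `2 * tExponent n c`.
tExponent qExponent : ∀ n → Code n → ℕ
tExponent zero    _       = 0
tExponent (suc n) (s , c) = toℕ s + tExponent n c
qExponent zero    _       = 0
qExponent (suc n) (s , c) = toℕ s + (qExponent n c + 2 * tExponent n c)

decode : ∀ n → Code n → Vec ℕ n
decode zero    _       = []
decode (suc n) (s , c) = (ceil n (hd (toList (decode n c))) + toℕ s) ∷ reflect (decode n c)

decode-tight : ∀ n c → Tight n (toList (decode n c))
decode-tight zero    _       = []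
decode-tight (suc n) (s , c) =
  subst (λ h → ceil n h ≤ x × x < ceil n h + suc n) (sym (hd-reflect (decode n c)))
    (m≤m+n _ _ , +-monoʳ-< (ceil n (hd (toList (decode n c)))) (toℕ<n s)) ∷
  reflect-tight (decode n c) (decode-tight n c)
  where x = ceil n (hd (toList (decode n c))) + toℕ s

-- The inverse construction: reflecting the tail gives the shorter sequence, and the excess of the
-- head over its least value is the new coordinate, bounded by tightness.
decode-surjective : ∀ n (v : Vec ℕ n) → Tight n (toList v) → ∃[ c ] decode n c ≡ v
decode-surjective zero    []      _                = tt , refl
decode-surjective (suc n) (x ∷ v) ((l , u) ∷ t)
  with m≤n⇒∃[o]m+o≡n l | decode-surjective n (reflect v) (reflect-tight v t)
... | d , refl | c , eq = (fromℕ< d< , c) , cong₂ _∷_ head≡ tail≡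
  where
  d< : d < suc n
  d< = +-cancelˡ-< (ceil n (hd (toList v))) d (suc n) u
  head≡ : ceil n (hd (toList (decode n c))) + toℕ (fromℕ< d<) ≡ ceil n (hd (toList v)) + d
  head≡ = cong₂ (λ h e → ceil n h + e) (trans (cong (hd ∘ toList) eq) (hd-reflect v)) (toℕ-fromℕ< d<)
  tail≡ : reflect (decode n c) ≡ v
  tail≡ = trans (cong reflect eq) (reflect-involutive v t)

decode-injective : ∀ n {c d} → decode n c ≡ decode n d → c ≡ d
decode-injective zero    _ = refl
decode-injective (suc n) {s , c} {s′ , d} eq = cong₂ _,_ s≡s′ (decode-injective n c≡d)
  where
  open ≡-Reasoning
  c≡d : decode n c ≡ decode n d
  c≡d = begin
    decode n c                      ≡⟨ reflect-involutive (decode n c) (decode-tight n c) ⟨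
    reflect (reflect (decode n c))  ≡⟨ cong reflect (Vec.∷-injectiveʳ eq) ⟩
    reflect (reflect (decode n d))  ≡⟨ reflect-involutive (decode n d) (decode-tight n d) ⟩
    decode n d                      ∎
  s≡s′ : s ≡ s′
  s≡s′ = toℕ-injective (+-cancelˡ-≡ (ceil n (hd (toList (decode n c)))) _ _
    (trans (Vec.∷-injectiveˡ eq) (cong (λ v → ceil n (hd (toList v)) + toℕ s′) (sym c≡d))))

-- `altSize-reflect` writes the rounded part of the head as a sum of two alternating sizes, one of
-- which cancels against the reflected tail.
altSize-decode : ∀ n c → altSize (toList (decode n c)) ≡ + tExponent n c
altSize-decode zero    _       = refl
altSize-decode (suc n) (s , c) = begin
  (+ C ℤ.+ + toℕ s) ℤ.- altSize (toList (reflect v))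
    ≡⟨ cong (λ x → (x ℤ.+ + toℕ s) ℤ.- altSize (toList (reflect v))) (altSize-reflect v (decode-tight n c)) ⟨
  ((altSize (toList (reflect v)) ℤ.+ altSize (toList v)) ℤ.+ + toℕ s) ℤ.- altSize (toList (reflect v))
    ≡⟨ cancel (altSize (toList (reflect v))) (altSize (toList v)) (+ toℕ s) ⟩
  + toℕ s ℤ.+ altSize (toList v)
    ≡⟨ cong (λ x → + toℕ s ℤ.+ x) (altSize-decode n c) ⟩
  + tExponent (suc n) (s , c) ∎
  where
  open ≡-Reasoning
  v = decode n c
  C = ceil n (hd (toList v))
  cancel : ∀ a′ a s → ((a′ ℤ.+ a) ℤ.+ s) ℤ.- a′ ≡ s ℤ.+ a
  cancel = solve-∀

sum-decode : ∀ n c → sum (toList (decode n c)) ≡ qExponent n c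
sum-decode zero    _       = refl
sum-decode (suc n) (s , c) = ℤ.+-injective (begin
  (+ C ℤ.+ + toℕ s) ℤ.+ + sum (toList (reflect v))
    ≡⟨ swap (+ C) (+ toℕ s) (+ sum (toList (reflect v))) ⟩
  + toℕ s ℤ.+ (+ C ℤ.+ + sum (toList (reflect v)))
    ≡⟨ cong (λ x → + toℕ s ℤ.+ x) (sum-reflect v (decode-tight n c)) ⟩
  + toℕ s ℤ.+ (+ sum (toList v) ℤ.+ + 2 ℤ.* altSize (toList v))
    ≡⟨ cong₂ (λ x y → + toℕ s ℤ.+ (+ x ℤ.+ y)) (sum-decode n c)
             (trans (cong (λ x → + 2 ℤ.* x) (altSize-decode n c)) (sym (ℤ.pos-* 2 (tExponent n c)))) ⟩
  + qExponent (suc n) (s , c) ∎)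
  where
  open ≡-Reasoning
  v = decode n c
  C = ceil n (hd (toList v))
  swap : ∀ a b c → (a ℤ.+ b) ℤ.+ c ≡ b ℤ.+ (a ℤ.+ c)
  swap = solve-∀

-- Deleting and restoring trailing zeros

hd-dropTrailingZeros : ∀ xs → hd (dropTrailingZeros xs) ≡ hd xs
hd-dropTrailingZeros []           = refl
hd-dropTrailingZeros (suc x ∷ xs) = refl
hd-dropTrailingZeros (zero  ∷ xs) with dropTrailingZeros xs
... | []    = refl
... | _ ∷ _ = refl

tl-dropTrailingZeros : ∀ x xs → tl (dropTrailingZeros (x ∷ xs)) ≡ dropTrailingZeros xs
tl-dropTrailingZeros (suc x) xs = refl
tl-dropTrailingZeros zero    xs with dropTrailingZeros xs
... | []    = refl
... | _ ∷ _ = refl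

-- The common length `n` determines how many zeros were deleted. Entries are recovered one by one
-- because `hd` and `tl` are compatible with the deletion.
dropTrailingZeros-injective : ∀ {n} (v w : Vec ℕ n) →
  dropTrailingZeros (toList v) ≡ dropTrailingZeros (toList w) → v ≡ w
dropTrailingZeros-injective []      []      _  = refl
dropTrailingZeros-injective (x ∷ v) (y ∷ w) eq =
  cong₂ _∷_
    (trans (sym (hd-dropTrailingZeros (x ∷ toList v))) (trans (cong hd eq) (hd-dropTrailingZeros (y ∷ toList w))))
    (dropTrailingZeros-injective v w
      (trans (sym (tl-dropTrailingZeros x (toList v))) (trans (cong tl eq) (tl-dropTrailingZeros y (toList w)))))

altSize-dropTrailingZeros : ∀ xs → altSize (dropTrailingZeros xs) ≡ altSize xs
altSize-dropTrailingZeros []           = refl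
altSize-dropTrailingZeros (suc x ∷ xs) = cong (λ y → + suc x ℤ.- y) (altSize-dropTrailingZeros xs)
altSize-dropTrailingZeros (zero  ∷ xs) with dropTrailingZeros xs | altSize-dropTrailingZeros xs
... | []     | eq = cong (λ y → 0ℤ ℤ.- y) eq
... | y ∷ ys | eq = cong (λ y → 0ℤ ℤ.- y) eq

sum-dropTrailingZeros : ∀ xs → sum (dropTrailingZeros xs) ≡ sum xs
sum-dropTrailingZeros []           = refl
sum-dropTrailingZeros (suc x ∷ xs) = cong (λ y → suc x + y) (sum-dropTrailingZeros xs)
sum-dropTrailingZeros (zero  ∷ xs) with dropTrailingZeros xs | sum-dropTrailingZeros xs
... | []     | eq = eq
... | y ∷ ys | eq = eq

positive∧hd≡0⇒[] : ∀ {xs} → All (_> 0) xs → hd xs ≡ 0 → xs ≡ []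
positive∧hd≡0⇒[] []       _    = refl
positive∧hd≡0⇒[] (() ∷ _) refl

ceil≤0⇒≡0 : ∀ n {z} → ceil n z ≤ 0 → z ≡ 0
ceil≤0⇒≡0 n c≤0 = n≤0⇒n≡0 (≤-trans (m≤m+n _ _) c≤0)

-- After a zero entry the slope condition forces the next entry to be zero, so every zero is a
-- trailing one.
slopes⇒dropTrailingZeros-positive : ∀ {n xs} → Slopes n xs → All (_> 0) (dropTrailingZeros xs)
slopes⇒dropTrailingZeros-positive []                   = []
slopes⇒dropTrailingZeros-positive {xs = suc _ ∷ _} (_ ∷ s) = s≤s z≤n ∷ slopes⇒dropTrailingZeros-positive s
slopes⇒dropTrailingZeros-positive {suc n} {zero ∷ xs} (l ∷ s)
  with dropTrailingZeros xs
     | positive∧hd≡0⇒[] (slopes⇒dropTrailingZeros-positive s)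
         (trans (hd-dropTrailingZeros xs) (ceil≤0⇒≡0 n l))
... | .[] | refl = []

slopes-dropTrailingZeros : ∀ {n xs} → Slopes n xs → Slopes n (dropTrailingZeros xs)
slopes-dropTrailingZeros []      = []
slopes-dropTrailingZeros {suc n} {suc x ∷ xs} (l ∷ s) =
  subst (λ h → ceil n h ≤ suc x) (sym (hd-dropTrailingZeros xs)) l ∷ slopes-dropTrailingZeros s
slopes-dropTrailingZeros {suc n} {zero ∷ xs} (l ∷ s)
  with dropTrailingZeros xs | slopes-dropTrailingZeros s | hd-dropTrailingZeros xs
... | []     | _  | _    = []
... | y ∷ ys | s′ | refl = l ∷ s′

slopes-dropTrailingZeros⁻ : ∀ {n} xs → length xs ≤ n → Slopes n (dropTrailingZeros xs) → Slopes n xs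
slopes-dropTrailingZeros⁻ []           _         _       = []
slopes-dropTrailingZeros⁻ {suc n} (suc x ∷ xs) (s≤s len) (l ∷ s) =
  subst (λ h → ceil n h ≤ suc x) (hd-dropTrailingZeros xs) l ∷ slopes-dropTrailingZeros⁻ xs len s
slopes-dropTrailingZeros⁻ {suc n} (zero ∷ xs) (s≤s len) s
  with dropTrailingZeros xs | hd-dropTrailingZeros xs | slopes-dropTrailingZeros⁻ {n} xs len
slopes-dropTrailingZeros⁻ {suc n} (zero ∷ xs) (s≤s len) s       | []     | eq   | ih =
  subst (λ h → ceil n h ≤ 0) eq (≤-reflexive (ceil-zero n)) ∷ ih []
slopes-dropTrailingZeros⁻ {suc n} (zero ∷ xs) (s≤s len) (l ∷ s) | y ∷ ys | refl | ih = l ∷ ih s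

tight-dropTrailingZeros : ∀ {n xs} → Tight n xs → Tight n (dropTrailingZeros xs)
tight-dropTrailingZeros []      = []
tight-dropTrailingZeros {suc n} {suc x ∷ xs} (b ∷ t) =
  subst (λ h → ceil n h ≤ suc x × suc x < ceil n h + suc n) (sym (hd-dropTrailingZeros xs)) b ∷
  tight-dropTrailingZeros t
tight-dropTrailingZeros {suc n} {zero ∷ xs} (b ∷ t)
  with dropTrailingZeros xs | tight-dropTrailingZeros t | hd-dropTrailingZeros xs
... | []     | _  | _    = []
... | y ∷ ys | t′ | refl = b ∷ t′

-- Padding zeros are tight because `ceil n 0` is 0, which is less than `suc n`.
tight-pad : ∀ {n xs} → Tight n xs → All (_> 0) xs →
            ∃[ v ] Tight n (toList v) × dropTrailingZeros (toList {n = n} v) ≡ xs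
tight-pad {zero} [] _ = [] , [] , refl
tight-pad {suc n} {[]} [] _ with tight-pad {n} [] []
... | v , t , eq = 0 ∷ v , (≤-reflexive C≡0 , m≤n⇒m≤o+n _ (s≤s z≤n)) ∷ t , drop {toList v} eq
  where
  C≡0 : ceil n (hd (toList v)) ≡ 0
  C≡0 = trans (cong (ceil n) (trans (sym (hd-dropTrailingZeros (toList v))) (cong hd eq))) (ceil-zero n)
  drop : ∀ {ys} → dropTrailingZeros ys ≡ [] → dropTrailingZeros (0 ∷ ys) ≡ []
  drop eq rewrite eq = refl
tight-pad {suc n} {suc x ∷ xs} (b ∷ t) (_ ∷ p) with tight-pad t p
... | v , t′ , refl =
  suc x ∷ v ,
  subst (λ h → ceil n h ≤ suc x × suc x < ceil n h + suc n) (hd-dropTrailingZeros (toList v)) b ∷ t′ ,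
  refl

-- Reduced lecture hall partitions as tight sequences

lectureHall⇒slopes : ∀ {n xs} → LectureHall n xs → Slopes n xs
lectureHall⇒slopes lh = slopes (LectureHall.length≤N lh) (LectureHall.ratios↘ lh)
  where
  slopes : ∀ {n xs} → length xs ≤ n → Linked ℚᵘ._≥_ (ratios n xs) → Slopes n xs
  slopes {xs = []}              _               _           = []
  slopes {suc n} {x ∷ []}       _               _           = subst (_≤ x) (sym (ceil-zero n)) z≤n ∷ []
  -- Here `r` is the comparison of y / (n+1) with x / (n+2), cross-multiplied over the integers.
  slopes {suc (suc n)} {x ∷ y ∷ xs} (s≤s len) (*≤* r ∷ rs) =
    slope⇒ceil {n} {x} {y} (ℤ.drop‿+≤+ (subst₂ ℤ._≤_ (sym (ℤ.pos-* y (suc (suc n)))) (sym (ℤ.pos-* x (suc n))) r)) ∷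
    slopes len rs

slopes⇒lectureHall : ∀ {n xs} → Slopes n xs → All (_> 0) xs → LectureHall n xs
slopes⇒lectureHall s p = record
  { partition = record { decreasing = decreasing s ; positive = p }
  ; length≤N  = slopes⇒length≤ s
  ; ratios↘   = linked s
  }
  where
  decreasing : ∀ {n xs} → Slopes n xs → Linked _≥_ xs
  decreasing []                    = []
  decreasing (_ ∷ [])              = [-]
  decreasing (l ∷ s@(_ ∷ _))       = ≤-trans (m≤m+n _ _) l ∷ decreasing s
  linked : ∀ {n xs} → Slopes n xs → Linked ℚᵘ._≥_ (ratios n xs)
  linked []       = []
  linked (_ ∷ []) = [-]
  linked {suc (suc n)} {x ∷ y ∷ xs} (l ∷ s@(_ ∷ _)) =
    *≤* (subst₂ ℤ._≤_ (ℤ.pos-* y (suc (suc n))) (ℤ.pos-* x (suc n)) (ℤ.+≤+ (ceil⇒slope {n} {x} {y} l))) ∷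
    linked s

-- The move excluded by reducedness, stated before trailing zeros are deleted, so that positions and
-- lengths are preserved.
Lowerable : (n : ℕ) (xs : List ℕ) → Fin (length xs) → Set
Lowerable n xs i = n ∸ toℕ i ≤ lookup xs i × Slopes n (xs [ i ]%= (_∸ (n ∸ toℕ i)))

-- Lowering an entry by its denominator lowers its quotient by 1, which takes it below the next
-- quotient.
tight⇒¬lowerable : ∀ {n xs} → Tight n xs → ∀ i → ¬ Lowerable n xs i
tight⇒¬lowerable {suc n} ((_ , u) ∷ t) zero    (n<x , l ∷ _) =
  <⇒≱ u (m≤o∸n⇒m+n≤o _ n<x l)
tight⇒¬lowerable         (_ ∷ t)       (suc i) (n≤x , _ ∷ s) = tight⇒¬lowerable t i (n≤x , s)

-- A head too large for tightness could itself be lowered. A move inside the tail is also a move of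
-- the whole list: it can only decrease the head of the tail, and `ceil` is monotone.
slopes∧¬lowerable⇒tight : ∀ {n xs} → Slopes n xs → (∀ i → ¬ Lowerable n xs i) → Tight n xs
slopes∧¬lowerable⇒tight [] _ = []
slopes∧¬lowerable⇒tight {suc n} {x ∷ xs} (l ∷ s) ¬low =
  (l , ≰⇒> λ C+n<x → ¬low zero (m+n≤o⇒n≤o _ C+n<x , m+n≤o⇒m≤o∸n _ C+n<x ∷ s)) ∷
  slopes∧¬lowerable⇒tight s λ i (n≤x , s′) → ¬low (suc i) (n≤x , ≤-trans (ceil-mono n (hd-%= (n ∸ toℕ i) xs i)) l ∷ s′)
  where
  hd-%= : ∀ k ys (i : Fin (length ys)) → hd (ys [ i ]%= (_∸ k)) ≤ hd ys
  hd-%= k (y ∷ ys) zero    = m∸n≤m y k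
  hd-%= k (y ∷ ys) (suc i) = ≤-refl

reduced⇒tight : ∀ {n xs} → ReducedLectureHall n xs → Tight n xs
reduced⇒tight {n} {xs} red = slopes∧¬lowerable⇒tight (lectureHall⇒slopes lectureHall) λ i (n≤x , s) →
  reduced i (n≤x , slopes⇒lectureHall (slopes-dropTrailingZeros s) (slopes⇒dropTrailingZeros-positive s))
  where open ReducedLectureHall red

tight⇒reduced : ∀ {n xs} → Tight n xs → All (_> 0) xs → ReducedLectureHall n xs
tight⇒reduced {n} {xs} t p = record
  { lectureHall = slopes⇒lectureHall (tight⇒slopes t) p
  ; reduced     = λ i (n≤x , lh) → tight⇒¬lowerable t i
      (n≤x , slopes-dropTrailingZeros⁻ _
        (subst (_≤ n) (sym (length-%= xs i (_∸ (n ∸ toℕ i)))) (slopes⇒length≤ (tight⇒slopes t)))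
        (lectureHall⇒slopes lh))
  }

lectureHallDecode : ∀ n → Code n → List ℕ
lectureHallDecode n c = dropTrailingZeros (toList (decode n c))

lectureHallDecode-injective : ∀ n {c d} → lectureHallDecode n c ≡ lectureHallDecode n d → c ≡ d
lectureHallDecode-injective n eq = decode-injective n (dropTrailingZeros-injective _ _ eq)

lectureHallDecode-reduced : ∀ n c → ReducedLectureHall n (lectureHallDecode n c)
lectureHallDecode-reduced n c =
  tight⇒reduced (tight-dropTrailingZeros t) (slopes⇒dropTrailingZeros-positive (tight⇒slopes t))
  where t = decode-tight n c

lectureHallDecode-surjective : ∀ n xs → ReducedLectureHall n xs → ∃[ c ] lectureHallDecode n c ≡ xs
lectureHallDecode-surjective n xs red
  with tight-pad (reduced⇒tight red) (IsPartition.positive (LectureHall.partition (ReducedLectureHall.lectureHall red)))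
... | v , t , refl with decode-surjective n v t
... | c , refl = c , refl

-- Odd partitions

-- The offset `i` makes 1 + 2i the smallest available part. Its copies come last, which keeps the
-- list decreasing.
oddDecode : ∀ n (i : ℕ) → Code n → List ℕ
oddDecode zero    i _       = []
oddDecode (suc n) i (s , c) = oddDecode n (suc i) c ++ replicate (toℕ s) (1 + 2 * i)

length-oddDecode : ∀ n i c → length (oddDecode n i c) ≡ tExponent n c
length-oddDecode zero    i _       = refl
length-oddDecode (suc n) i (s , c) = begin
  length (oddDecode n (suc i) c ++ replicate (toℕ s) (1 + 2 * i))  ≡⟨ length-++ (oddDecode n (suc i) c) ⟩
  length (oddDecode n (suc i) c) + length (replicate (toℕ s) (1 + 2 * i))
    ≡⟨ cong₂ _+_ (length-oddDecode n (suc i) c) (length-replicate (toℕ s)) ⟩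
  tExponent n c + toℕ s  ≡⟨ +-comm (tExponent n c) (toℕ s) ⟩
  toℕ s + tExponent n c  ∎
  where open ≡-Reasoning

sum-replicate : ∀ n x → sum (replicate n x) ≡ n * x
sum-replicate zero    x = refl
sum-replicate (suc n) x = cong (λ y → x + y) (sum-replicate n x)

sum-oddDecode : ∀ n i c → sum (oddDecode n i c) ≡ qExponent n c + 2 * i * tExponent n c
sum-oddDecode zero    i _       = sym (*-zeroʳ (2 * i))
sum-oddDecode (suc n) i (s , c) = begin
  sum (oddDecode n (suc i) c ++ replicate (toℕ s) (1 + 2 * i))
    ≡⟨ sum-++ (oddDecode n (suc i) c) _ ⟩
  sum (oddDecode n (suc i) c) + sum (replicate (toℕ s) (1 + 2 * i))
    ≡⟨ cong₂ _+_ (sum-oddDecode n (suc i) c) (sum-replicate (toℕ s) (1 + 2 * i)) ⟩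
  qExponent n c + 2 * suc i * tExponent n c + toℕ s * (1 + 2 * i)
    ≡⟨ rearrange (qExponent n c) i (tExponent n c) (toℕ s) ⟩
  toℕ s + (qExponent n c + 2 * tExponent n c) + 2 * i * (toℕ s + tExponent n c) ∎
  where
  open ≡-Reasoning
  rearrange : ∀ b i a s → b + 2 * suc i * a + s * (1 + 2 * i) ≡ s + (b + 2 * a) + 2 * i * (s + a)
  rearrange = ℕ-Solver.solve-∀

mult-++ : ∀ d xs ys → mult d (xs ++ ys) ≡ mult d xs + mult d ys
mult-++ d xs ys = trans (cong length (filter-++ (_≟ d) xs ys)) (length-++ (filter (_≟ d) xs))

mult-absent : ∀ {d xs} → All (_≢ d) xs → mult d xs ≡ 0
mult-absent {d} absent = cong length (filter-none (_≟ d) absent)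

mult-replicate : ∀ s d → mult d (replicate s d) ≡ s
mult-replicate s d = trans (cong length (filter-all (_≟ d) (All.replicate⁺ s refl))) (length-replicate s)

mult-last : ∀ {k xs} s → All (k <_) xs → mult k (xs ++ replicate s k) ≡ s
mult-last {k} {xs} s k< = begin
  mult k (xs ++ replicate s k)          ≡⟨ mult-++ k xs _ ⟩
  mult k xs + mult k (replicate s k)    ≡⟨ cong₂ _+_ (mult-absent (All.map >⇒≢ k<)) (mult-replicate s k) ⟩
  s                                     ∎
  where open ≡-Reasoning

OddBetween : ℕ → ℕ → ℕ → Set
OddBetween n i x = 2 ∤ x × 1 + 2 * i ≤ x × x ≤ 2 * (i + n)

odd-∤ : ∀ i → 2 ∤ 1 + 2 * i
odd-∤ i 2∣ = >⇒∤ (s≤s (s≤s z≤n)) (∣m+n∣m⇒∣n (subst (2 ∣_) (+-comm 1 (2 * i)) 2∣) (m∣m*n i))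

1+2*suc : ∀ i → 1 + 2 * suc i ≡ 3 + 2 * i
1+2*suc = ℕ-Solver.solve-∀

2*[suc+] : ∀ i n → 2 * (suc i + n) ≡ 2 * (i + suc n)
2*[suc+] i n = cong (2 *_) (sym (+-suc i n))

oddDecode-oddBetween : ∀ n i c → All (OddBetween n i) (oddDecode n i c)
oddDecode-oddBetween zero    i _       = []
oddDecode-oddBetween (suc n) i (s , c) =
  All.++⁺ (All.map widen (oddDecode-oddBetween n (suc i) c))
          (All.replicate⁺ (toℕ s) (odd-∤ i , ≤-refl , ≤-trans (n≤1+n _) upper))
  where
  widen : ∀ {x} → OddBetween n (suc i) x → OddBetween (suc n) i x
  widen (odd , l , u) =
    odd , ≤-trans (s≤s (*-monoʳ-≤ 2 (n≤1+n i))) l , ≤-trans u (≤-reflexive (2*[suc+] i n))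
  upper : 2 + 2 * i ≤ 2 * (i + suc n)
  upper = ≤-trans (≤-reflexive (sym (*-suc 2 i))) (*-monoʳ-≤ 2 (≤-trans (s≤s (m≤m+n i n)) (≤-reflexive (sym (+-suc i n)))))

oddDecode-> : ∀ n i c → All (1 + 2 * i <_) (oddDecode n (suc i) c)
oddDecode-> n i c = All.map above (oddDecode-oddBetween n (suc i) c)
  where
  above : ∀ {x} → OddBetween n (suc i) x → 1 + 2 * i < x
  above (_ , l , _) = ≤-trans (n≤1+n _) (≤-trans (≤-reflexive (sym (1+2*suc i))) l)

replicate-AllPairs : ∀ s x → AllPairs _≥_ (replicate s x)
replicate-AllPairs zero    x = []
replicate-AllPairs (suc s) x = All.replicate⁺ s ≤-refl ∷ replicate-AllPairs s x

oddDecode-decreasing : ∀ n i c → AllPairs _≥_ (oddDecode n i c)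
oddDecode-decreasing zero    i _       = []
oddDecode-decreasing (suc n) i (s , c) =
  AllPairs.++⁺ (oddDecode-decreasing n (suc i) c) (replicate-AllPairs (toℕ s) _)
    (All.map (λ k<x → All.replicate⁺ (toℕ s) (<⇒≤ k<x)) (oddDecode-> n i c))

oddDecode-mult : ∀ n i c j → j < n → mult (1 + 2 * (i + j)) (oddDecode n i c) ≤ n ∸ suc j
oddDecode-mult (suc n) i (s , c) zero    _ = begin
  mult (1 + 2 * (i + 0)) (oddDecode (suc n) i (s , c))  ≡⟨ cong (λ k → mult (1 + 2 * k) (oddDecode (suc n) i (s , c))) (+-identityʳ i) ⟩
  mult (1 + 2 * i) (oddDecode (suc n) i (s , c))        ≡⟨ mult-last (toℕ s) (oddDecode-> n i c) ⟩
  toℕ s                                                 ≤⟨ toℕ≤pred[n] s ⟩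
  n                                                     ∎
  where open ≤-Reasoning
oddDecode-mult (suc n) i (s , c) (suc j) (s≤s j<n) = begin
  mult d (oddDecode n (suc i) c ++ replicate (toℕ s) (1 + 2 * i))     ≡⟨ mult-++ d (oddDecode n (suc i) c) _ ⟩
  mult d (oddDecode n (suc i) c) + mult d (replicate (toℕ s) (1 + 2 * i))
    ≡⟨ cong₂ _+_ (cong (λ k → mult (1 + 2 * k) (oddDecode n (suc i) c)) (+-suc i j))
                 (mult-absent (All.replicate⁺ (toℕ s) (<⇒≢ k<d))) ⟩
  mult (1 + 2 * (suc i + j)) (oddDecode n (suc i) c) + 0              ≡⟨ +-identityʳ _ ⟩
  mult (1 + 2 * (suc i + j)) (oddDecode n (suc i) c)                  ≤⟨ oddDecode-mult n (suc i) c j j<n ⟩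
  n ∸ suc j                                                           ∎
  where
  open ≤-Reasoning
  d = 1 + 2 * (i + suc j)
  k<d : 1 + 2 * i < d
  k<d = s≤s (*-monoʳ-< 2 (m<m+n i (s≤s z≤n)))

-- The multiplicity of the smallest available part determines the first coordinate; cancelling the
-- common suffix leaves the rest.
oddDecode-injective : ∀ n i {c d} → oddDecode n i c ≡ oddDecode n i d → c ≡ d
oddDecode-injective zero    i _ = refl
oddDecode-injective (suc n) i {s , c} {s′ , d} eq with toℕ-injective {i = s} {s′} s≡s′
  where
  s≡s′ : toℕ s ≡ toℕ s′
  s≡s′ = begin
    toℕ s                                            ≡⟨ mult-last (toℕ s) (oddDecode-> n i c) ⟨
    mult (1 + 2 * i) (oddDecode (suc n) i (s , c))   ≡⟨ cong (mult (1 + 2 * i)) eq ⟩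
    mult (1 + 2 * i) (oddDecode (suc n) i (s′ , d))  ≡⟨ mult-last (toℕ s′) (oddDecode-> n i d) ⟩
    toℕ s′                                           ∎
    where open ≡-Reasoning
... | refl = cong (s ,_) (oddDecode-injective n (suc i) (++-cancelʳ _ _ _ eq))

split-minimum : ∀ k {xs} → AllPairs _≥_ xs → All (k ≤_) xs →
                ∃₂ λ ys s → xs ≡ ys ++ replicate s k × All (k <_) ys
split-minimum k {[]}     _         _          = [] , 0 , refl , []
split-minimum k {x ∷ xs} (x≥ ∷ xs↘) (k≤x ∷ k≤) with k ≟ x | split-minimum k xs↘ k≤
... | no k≢x   | ys , s , refl , k< = x ∷ ys , s , refl , ≤∧≢⇒< k≤x k≢x ∷ k<
... | yes refl | [] , s , refl , _  = [] , suc s , refl , []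
-- A later entry `y` exceeding `x = k` would contradict the decreasing order.
... | yes refl | y ∷ ys , s , refl , k<y ∷ _ = contradiction (All.head x≥) (<⇒≱ k<y)

-- Splitting off the copies of 1 + 2i leaves odd parts of size at least 3 + 2i. The multiplicity
-- bound at `j = 0` makes the number of copies a valid coordinate.
oddDecode-surjective : ∀ n i xs → AllPairs _≥_ xs → All (OddBetween n i) xs →
  (∀ j → j < n → mult (1 + 2 * (i + j)) xs ≤ n ∸ suc j) → ∃[ c ] oddDecode n i c ≡ xs
oddDecode-surjective zero i []       _ _             _ = tt , refl
oddDecode-surjective zero i (x ∷ xs) _ ((_ , l , u) ∷ _) _ =
  contradiction (≤-trans u (≤-reflexive (cong (2 *_) (+-identityʳ i)))) (<⇒≱ l)
oddDecode-surjective (suc n) i xs xs↘ between mult≤ with split-minimum (1 + 2 * i) xs↘ (All.map (proj₁ ∘ proj₂) between)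
... | ys , s , refl , k< with oddDecode-surjective n (suc i) ys
        (AllPairs-++⁻ˡ ys xs↘) (All.zipWith narrow (k< , All.++⁻ˡ ys between)) mult≤′
  where
  AllPairs-++⁻ˡ : ∀ ys {zs} → AllPairs _≥_ (ys ++ zs) → AllPairs _≥_ ys
  AllPairs-++⁻ˡ []       _        = []
  AllPairs-++⁻ˡ (y ∷ ys) (y≥ ∷ p) = All.++⁻ˡ ys y≥ ∷ AllPairs-++⁻ˡ ys p
  narrow : ∀ {x} → 1 + 2 * i < x × OddBetween (suc n) i x → OddBetween n (suc i) x
  narrow {x} (k<x , odd , _ , u) =
    odd ,
    -- From `1 + 2 * i < x`, parity excludes x = 2 + 2i, so x is at least 3 + 2i.
    ≤-trans (≤-reflexive (1+2*suc i)) (≤∧≢⇒< k<x λ { refl → odd (subst (2 ∣_) (*-suc 2 i) (m∣m*n (suc i))) }) ,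
    ≤-trans u (≤-reflexive (sym (2*[suc+] i n)))
  mult≤′ : ∀ j → j < n → mult (1 + 2 * (suc i + j)) ys ≤ n ∸ suc j
  mult≤′ j j<n = begin
    mult (1 + 2 * (suc i + j)) ys                               ≡⟨ cong (λ k → mult (1 + 2 * k) ys) (+-suc i j) ⟨
    mult (1 + 2 * (i + suc j)) ys                               ≤⟨ m≤m+n _ _ ⟩
    mult (1 + 2 * (i + suc j)) ys + mult (1 + 2 * (i + suc j)) (replicate s (1 + 2 * i))
                                                                ≡⟨ mult-++ (1 + 2 * (i + suc j)) ys _ ⟨
    mult (1 + 2 * (i + suc j)) (ys ++ replicate s (1 + 2 * i))  ≤⟨ mult≤ (suc j) (s≤s j<n) ⟩
    n ∸ suc j                                                   ∎
    where open ≤-Reasoning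
... | c , refl = (fromℕ< s< , c) , cong (λ m → oddDecode n (suc i) c ++ replicate m (1 + 2 * i)) (toℕ-fromℕ< s<)
  where
  s< : s < suc n
  s< = s≤s (begin
    s                                                       ≡⟨ mult-last s k< ⟨
    mult (1 + 2 * i) (ys ++ replicate s (1 + 2 * i))        ≡⟨ cong (λ k → mult (1 + 2 * k) (ys ++ replicate s (1 + 2 * i))) (+-identityʳ i) ⟨
    mult (1 + 2 * (i + 0)) (ys ++ replicate s (1 + 2 * i))  ≤⟨ mult≤ 0 (s≤s z≤n) ⟩
    n                                                       ∎)
    where open ≤-Reasoning


2*suc∸1 : ∀ j → 2 * suc j ∸ 1 ≡ 1 + 2 * j
2*suc∸1 j = cong (_∸ 1) (*-suc 2 j)

oddDecode-reduced : ∀ N c → ReducedOddPartition N (oddDecode N 0 c)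
oddDecode-reduced N c = record
  { oddPartition = record
    { partition = record
      { decreasing = Linked.AllPairs⇒Linked (oddDecode-decreasing N 0 c)
      ; positive   = All.map (proj₁ ∘ proj₂) between
      }
    ; odd     = All.map proj₁ between
    ; bounded = All.map (proj₂ ∘ proj₂) between
    }
  ; mult≤ = λ { (suc j) _ j<N → subst (λ d → mult d (oddDecode N 0 c) ≤ N ∸ suc j) (sym (2*suc∸1 j)) (oddDecode-mult N 0 c j j<N) }
  }
  where between = oddDecode-oddBetween N 0 c

reduced⇒oddDecode : ∀ N xs → ReducedOddPartition N xs → ∃[ c ] oddDecode N 0 c ≡ xs
reduced⇒oddDecode N xs rop = oddDecode-surjective N 0 xs
  (Linked.Linked⇒AllPairs (λ y≤x z≤y → ≤-trans z≤y y≤x) decreasing)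
  (All.zip (odd , All.zip (positive , bounded)))
  λ j j<N → subst (λ d → mult d xs ≤ N ∸ suc j) (2*suc∸1 j) (mult≤ (suc j) (s≤s z≤n) j<N)
  where
  open ReducedOddPartition rop
  open OddPartition oddPartition
  open IsPartition partition

-- Counting by codes

codes : ∀ n → List (Code n)
codes zero    = tt ∷ []
codes (suc n) = cartesianProduct (allFin (suc n)) (codes n)

codes-unique : ∀ n → Unique (codes n)
codes-unique zero    = [] ∷ []
codes-unique (suc n) = Unique.cartesianProduct⁺ (Unique.allFin⁺ (suc n)) (codes-unique n)

∈-codes : ∀ n c → c ∈ codes n
∈-codes zero    _       = here refl
∈-codes (suc n) (s , c) = ∈-cartesianProduct⁺ (∈-allFin s) (∈-codes n c)

-- A weight-preserving bijection `f` from a finite list without repetitions carries the codes of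
-- given weights to exactly the required elements of `P`.
isSum-gf : ∀ {C : Set} {cs : List C} → Unique cs → (∀ c → c ∈ cs) →
  ∀ {tExp qExp : C → ℕ} {f : C → List ℕ} {P e s} →
  (∀ {c d} → f c ≡ f d → c ≡ d) → (∀ c → P (f c)) → (∀ x → P x → ∃[ c ] f c ≡ x) →
  (∀ c → e (f c) ≡ + tExp c) → (∀ c → s (f c) ≡ qExp c) → IsSum P e s (gf tExp qExp cs)
isSum-gf {C} {cs} unique complete {tExp} {qExp} {f} {P} {e} {s} injective sound surjective e≡ s≡ = record
  { exponent≥0  = exponent≥0
  ; coefficient = λ a b →
      map f (selected a b) ,
      Unique.map⁺ injective (Unique.filter⁺ (weight? a b) unique) ,
      (λ x → mk⇔ (to a b x) (from a b x)) ,
      trans (gf-count tExp qExp cs a b) (cong +_ (sym (length-map f (selected a b))))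
  }
  where
  weight? : ∀ a b c → Dec (a ≡ tExp c × b ≡ qExp c)
  weight? a b c = (a ≟ tExp c) ×-dec (b ≟ qExp c)
  selected : ℕ → ℕ → List C
  selected a b = filter (weight? a b) cs
  exponent≥0 : ∀ x → P x → 0ℤ ℤ.≤ e x
  exponent≥0 x Px with surjective x Px
  ... | c , refl = subst (0ℤ ℤ.≤_) (sym (e≡ c)) (ℤ.+≤+ z≤n)
  to : ∀ a b x → x ∈ map f (selected a b) → P x × e x ≡ + a × s x ≡ b
  to a b x x∈ with ∈-map∘filter⁻ f (weight? a b) {xs = cs} x∈
  ... | c , _ , refl , refl , refl = sound c , e≡ c , s≡ c
  from : ∀ a b x → P x × e x ≡ + a × s x ≡ b → x ∈ map f (selected a b)
  from a b x (Px , ex≡a , sx≡b) with surjective x Px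
  ... | c , refl = ∈-map∘filter⁺ f (weight? a b)
    (c , complete c , refl , ℤ.+-injective (trans (sym ex≡a) (e≡ c)) , trans (sym sx≡b) (s≡ c))

-- The offset `i` grows as factors are split off, because the first remaining factor then belongs to
-- the part 1 + 2i. It adds 2i to the weight of each unit of the code.
∏-gf : ∀ n i (f : ℕ → Series) →
  (∀ j → j < n → f j ≈ˢ gf toℕ (λ s → toℕ s * (1 + 2 * (j + i))) (allFin (n ∸ j))) →
  foldr _*ˢ_ 1ˢ (applyUpTo f n) ≈ˢ gf (tExponent n) (λ c → qExponent n c + 2 * i * tExponent n c) (codes n)
∏-gf zero    i f f≈ a b = sym (trans (ℤ.+-identityʳ _) (cong (λ n → (t^ 0 q^ n) a b) (*-zeroʳ (2 * i))))
∏-gf (suc n) i f f≈ a b = begin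
  (f 0 *ˢ foldr _*ˢ_ 1ˢ (applyUpTo (f ∘ suc) n)) a b
    ≡⟨ *ˢ-cong (f≈ 0 (s≤s z≤n)) (∏-gf n (suc i) (f ∘ suc) f≈′) a b ⟩
  (gf toℕ (λ s → toℕ s * (1 + 2 * i)) (allFin (suc n)) *ˢ
   gf (tExponent n) (λ c → qExponent n c + 2 * suc i * tExponent n c) (codes n)) a b
    ≡⟨ gf-× toℕ (λ s → toℕ s * (1 + 2 * i)) (tExponent n) (λ c → qExponent n c + 2 * suc i * tExponent n c)
            (allFin (suc n)) (codes n) a b ⟩
  gf (tExponent (suc n)) (λ (s , c) → toℕ s * (1 + 2 * i) + (qExponent n c + 2 * suc i * tExponent n c)) (codes (suc n)) a b
    ≡⟨ gf-cong {e = tExponent (suc n)} (λ _ → refl) (λ (s , c) → rearrange (qExponent n c) i (tExponent n c) (toℕ s)) (codes (suc n)) a b ⟩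
  gf (tExponent (suc n)) (λ c → qExponent (suc n) c + 2 * i * tExponent (suc n) c) (codes (suc n)) a b ∎
  where
  open ≡-Reasoning
  f≈′ : ∀ j → j < n → f (suc j) ≈ˢ gf toℕ (λ s → toℕ s * (1 + 2 * (j + suc i))) (allFin (n ∸ j))
  f≈′ j j<n = subst (λ k → f (suc j) ≈ˢ gf toℕ (λ s → toℕ s * (1 + 2 * k)) (allFin (n ∸ j)))
                    (sym (+-suc j i)) (f≈ (suc j) (s≤s j<n))
  rearrange : ∀ b i a s → s * (1 + 2 * i) + (b + 2 * suc i * a) ≡ s + (b + 2 * a) + 2 * i * (s + a)
  rearrange = ℕ-Solver.solve-∀

-- Trapezoidal numbers and the factors of the product

sum-arithmetic : ∀ {f : ℕ → ℕ} lo k → (∀ i → f i ≡ lo + i) →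
                 2 * sum (applyUpTo f k) + k ≡ k * (2 * lo + k)
sum-arithmetic lo zero    f≗ = refl
sum-arithmetic {f} lo (suc k) f≗ = begin
  2 * (f 0 + S) + suc k                  ≡⟨ cong (λ x → 2 * (x + S) + suc k) (f≗ 0) ⟩
  2 * (lo + 0 + S) + suc k               ≡⟨ collect lo S k ⟩
  2 * lo + 1 + (2 * S + k)               ≡⟨ cong (λ x → 2 * lo + 1 + x) (sum-arithmetic (suc lo) k λ i → trans (f≗ (suc i)) (+-suc lo i)) ⟩
  2 * lo + 1 + k * (2 * suc lo + k)      ≡⟨ expand lo k ⟩
  suc k * (2 * lo + suc k)               ∎
  where
  open ≡-Reasoning
  S = sum (applyUpTo (f ∘ suc) k)
  collect : ∀ lo S k → 2 * (lo + 0 + S) + suc k ≡ 2 * lo + 1 + (2 * S + k)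
  collect = ℕ-Solver.solve-∀
  expand : ∀ lo k → 2 * lo + 1 + k * (2 * suc lo + k) ≡ suc k * (2 * lo + suc k)
  expand = ℕ-Solver.solve-∀

-- The total is checked through the arithmetic series formula, doubled to avoid division and with
-- `k` moved across to avoid subtraction.
sumFromTo-≡ : ∀ lo hi k total → suc hi ∸ lo ≡ k → 2 * total + k ≡ k * (2 * lo + k) →
              sumFromTo lo hi ≡ total
sumFromTo-≡ lo hi k total refl eq =
  *-cancelˡ-≡ _ _ 2 (+-cancelʳ-≡ k _ _ (trans (sum-arithmetic lo k λ _ → refl) (sym eq)))

-- With k = `suc j` and N = `suc j + m`, the first case sums 2k-1 integers of mean N-k+1, the second
-- 2(N-k+1) integers of mean (2k-1)/2. Both give (N-k+1)(2k-1).
◇-product : ∀ j m → ◇ (suc j + m) (suc j) ≡ suc m * (1 + 2 * j)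
◇-product j m with 2 * suc j ≤? suc j + m
... | yes 2k≤N rewrite dec-true (2 * suc j ≤? suc j + m) 2k≤N =
  few (m≤n⇒∃[o]m+o≡n (+-cancelˡ-≤ (suc j) (suc j + 0) m 2k≤N))
  where
  low : ∀ j r → suc j + (suc j + 0 + r) + 2 ≡ 2 * suc j + (2 + r)
  low = ℕ-Solver.solve-∀
  count : ∀ j r → suc (suc j + (suc j + 0 + r)) ≡ 2 + r + (1 + 2 * j)
  count = ℕ-Solver.solve-∀
  total : ∀ j r → 2 * (suc (suc j + 0 + r) * (1 + 2 * j)) + (1 + 2 * j) ≡ (1 + 2 * j) * (2 * (2 + r) + (1 + 2 * j))
  total = ℕ-Solver.solve-∀
  few : ∀ {m} → ∃[ r ] suc j + 0 + r ≡ m → sumFromTo (suc j + m + 2 ∸ 2 * suc j) (suc j + m) ≡ suc m * (1 + 2 * j)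
  few (r , refl) rewrite trans (cong (_∸ 2 * suc j) (low j r)) (m+n∸m≡n (2 * suc j) (2 + r)) =
    sumFromTo-≡ (2 + r) (suc j + (suc j + 0 + r)) (1 + 2 * j) _ (trans (cong (_∸ (2 + r)) (count j r)) (m+n∸m≡n (2 + r) (1 + 2 * j))) (total j r)
... | no 2k≰N rewrite dec-false (2 * suc j ≤? suc j + m) 2k≰N =
  many (m≤n⇒∃[o]m+o≡n (≤-pred (≤-trans (+-cancelˡ-< (suc j) m (suc j + 0) (≰⇒> 2k≰N)) (≤-reflexive (+-identityʳ (suc j))))))
  where
  low : ∀ m r → 2 * suc (m + r) ≡ suc (m + r) + m + 1 + r
  low = ℕ-Solver.solve-∀
  count : ∀ m r → suc (suc (m + r) + m) ≡ r + (2 + 2 * m)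
  count = ℕ-Solver.solve-∀
  total : ∀ m r → 2 * (suc m * (1 + 2 * (m + r))) + (2 + 2 * m) ≡ (2 + 2 * m) * (2 * r + (2 + 2 * m))
  total = ℕ-Solver.solve-∀
  many : ∀ {j} → ∃[ r ] m + r ≡ j → sumFromTo (2 * suc j ∸ (suc j + m + 1)) (suc j + m) ≡ suc m * (1 + 2 * j)
  many (r , refl) rewrite trans (cong (_∸ (suc (m + r) + m + 1)) (low m r)) (m+n∸m≡n (suc (m + r) + m + 1) r) =
    sumFromTo-≡ r (suc (m + r) + m) (2 + 2 * m) _ (trans (cong (_∸ r) (count m r)) (m+n∸m≡n r (2 + 2 * m))) (total m r)

factor : ∀ N j → j < N →
  (1ˢ -ˢ t^ (N ∸ suc j + 1) q^ (◇ N (suc j))) /ˢ (1ˢ -ˢ t^ 1 q^ (2 * suc j ∸ 1)) ≈ˢ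
  gf toℕ (λ s → toℕ s * (1 + 2 * (j + 0))) (allFin (N ∸ j))
factor N j j<N with m≤n⇒∃[o]m+o≡n j<N
... | m , refl = congruent
  (trans (cong (_+ 1) (m+n∸m≡n (suc j) m)) (+-comm m 1))
  (◇-product j m)
  (2*suc∸1 j)
  (cong (λ k → 1 + 2 * k) (+-identityʳ j))
  (trans (cong (_∸ j) (sym (+-suc j m))) (m+n∸m≡n j (suc m)))
  where
  congruent : ∀ {A D S S′ K s} → A ≡ suc m → D ≡ suc m * s → S ≡ s → S′ ≡ s → K ≡ suc m →
    (1ˢ -ˢ t^ A q^ D) /ˢ (1ˢ -ˢ t^ 1 q^ S) ≈ˢ gf toℕ (λ j → toℕ j * S′) (allFin K)
  congruent {s = s} refl refl refl refl refl = finite-geometric m s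

theorem4p3 : ∀ (N : ℕ) .{{_ : NonZero N}} →
    ∃₂ λ (F G : Series) →
    IsSum (ReducedOddPartition N) (λ xs → + length xs) sum F ×
    IsSum (ReducedLectureHall N) altSize sum G ×
    F ≈ˢ G ×
    G ≈ˢ (∏[1≤ k ≤ N ] ((1ˢ -ˢ t^ (N ∸ k + 1) q^ (◇ N k)) /ˢ (1ˢ -ˢ t^ 1 q^ (2 * k ∸ 1))))
theorem4p3 N =
  -- Both families have the same codes with the same exponents, so one series serves for both.
  F , F ,
  isSum-gf (codes-unique N) (∈-codes N) (oddDecode-injective N 0) (oddDecode-reduced N) (reduced⇒oddDecode N)
    (λ c → cong +_ (length-oddDecode N 0 c))
    (λ c → trans (sum-oddDecode N 0 c) (+-identityʳ _)) ,
  isSum-gf (codes-unique N) (∈-codes N) (lectureHallDecode-injective N) (lectureHallDecode-reduced N) (lectureHallDecode-surjective N)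
    (λ c → trans (altSize-dropTrailingZeros (toList (decode N c))) (altSize-decode N c))
    (λ c → trans (sum-dropTrailingZeros (toList (decode N c))) (sum-decode N c)) ,
  (λ a b → refl) ,
  λ a b → trans (gf-cong {e = tExponent N} (λ _ → refl) (λ c → sym (+-identityʳ (qExponent N c))) (codes N) a b)
                (sym (∏-gf N 0 _ (factor N) a b))
  where
  F = gf (tExponent N) (qExponent N) (codes N)
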